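{- Let $\mathcal{A}$ be a finite set of universally quantified axioms, $\mathcal{D}$ a set of recursive definitions, $\mathcal{G}$ a grammar for lemmas, and $\alpha$ a universally quantified goal sentence (all quantification over the foreground sort). Suppose that $\alpha$ is provable from $\mathcal{A}$ and $\mathcal{D}$ by a finite set of independent inductive lemmas in $\mathcal{G}$, i.e. there are lemmas $L_1,\dots,L_n\in \mathrm{Lang}(\mathcal{G})$ such that $\mathcal{A}\cup\mathcal{D}^{\mathrm{fp}}\cup\{L_1,\dots,L_n\}\models_{\mathsf{FO}}\alpha$ and $\mathcal{A}\cup\mathcal{D}^{\mathrm{fp}}\models_{\mathsf{FO}}\mathrm{PFP}(L_i)$ for each $1\le i\le n$. Then there are an instantiation depth $k$ and a grammar height $h$ such that the algorithm $\mathrm{FOSSIL}(\mathcal{A},\mathcal{D},\mathcal{G},\alpha;k,h)$ terminates and returns a sequence $\mathcal{L}=(L'_1,\dots,L'_m)$ of lemmas that proves $\alpha$, i.e. $\mathcal{A}\cup\mathcal{D}^{\mathrm{fp}}\cup\{L'_1,\dots,L'_m\}\models_{\mathsf{FO}}\alpha$ and $\mathcal{A}\cup\mathcal{D}^{\mathrm{fp}}\cup\{L'_1,\dots,L'_{i-1}\}\models_{\mathsf{FO}}\mathrm{PFP}(L'_i)$ for each $1\le i\le m$.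
   Context: **Logic.** We use many-sorted first-order logic with equality over a signature with a distinguished foreground sort $\sigma_0$ and background sorts; the universes of the sorts are pairwise disjoint. There is at least one constant symbol of sort $\sigma_0$. For each background sort $\sigma$, the constants, functions and relations involving only $\sigma$ are constrained by an arbitrary first-order theory $T_\sigma$. All symbols involving the foreground sort or several background sorts are uninterpreted. Models are models of the combined theories. Satisfiability of quantifier-free formulas under the combined theories is decidable, and satisfying models can be produced for satisfiable quantifier-free formulas. All axioms, goals and lemmas quantify only over the foreground sort. **Recursive definitions.** A subset $\mathcal{R}^{\mathrm{rec}}$ of the relation symbols, relating elements of the foreground sort only, is given definitions. $\mathcal{D}$ contains for each $R\in\mathcal{R}^{\mathrm{rec}}$ exactly one definition $R(\overline{x}) :=_{\mathrm{lfp}} \rho_R(\overline{x})$, with $\rho_R$ quantifier-free and all symbols of $\mathcal{R}^{\mathrm{rec}}$ occurring only positively in $\rho_R$. Under lfp semantics ($\models_{\mathsf{LFP}}$) the relations in $\mathcal{R}^{\mathrm{rec}}$ are interpreted as the (simultaneous) least fixpoint of these definitions. $\mathcal{D}^{\mathrm{fp}}$ is the set of first-order sentences $\forall\overline{x}.\,R(\overline{x})\leftrightarrow\rho_R(\overline{x})$, and $\models_{\mathsf{FO}}$ is first-order entailment modulo the combined theories. **Lemmas.** Lemmas have the form $L=\forall\overline{x}.\,R(\overline{x})\to\psi(\overline{x})$ with $\overline{x}$ foreground variables, $R\in\mathcal{R}^{\mathrm{rec}}$ and $\psi$ quantifier-free. $\mathrm{PFP}(L):=\forall\overline{x}.\,\rho_R(\overline{x},R\wedge\psi)\to\psi(\overline{x})$,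 where $\rho_R(\overline{x},R\wedge\psi)$ is obtained from $\rho_R(\overline{x})$ by replacing every occurrence $R(\overline{t})$ by $\psi(\overline{t})\wedge R(\overline{t})$. $L(\overline{c})$ and $\mathrm{PFP}(L)(\overline{c})$ denote the instances at a tuple $\overline{c}$. **Systematic quantifier instantiation (SQI).** To check a formula $\varphi$, negate and Skolemize it to obtain $\forall\overline{x}.\,\eta(\overline{x})$ with $\eta$ quantifier-free. Let $T_k$ be the set of ground terms of foreground sort of depth at most $k$ (over the signature including the Skolem symbols). For a universal formula (or a set of such) $\Psi$, $\Psi[T_k]$ is the set of all instances of its matrix by tuples of terms from $T_k$. $\mathrm{SQI}(\varphi,k)$ returns VALID iff $(\forall\overline{x}.\,\eta)[T_k]$ is unsatisfiable (modulo the combined theories). **Grammar.** For $h\in\mathbb{N}$, $\mathcal{G}_h$ is the subgrammar of $\mathcal{G}$ whose language $\mathrm{Lang}(\mathcal{G}_h)$ consists of the formulas having a parse tree in $\mathcal{G}$ of height at most $h$; this language is finite. **Counterexamples.** Let $\mathrm{ctx}=\bigwedge(\mathcal{A}\cup\mathcal{D}^{\mathrm{fp}}\cup\mathcal{L})$, where $\mathcal{L}$ is the current sequence of lemmas. Counterexamples are models (represented by conjunctive ground formulas): - *Type-1*: a model of $(\mathrm{ctx}\wedge\neg\alpha[\overline{c}])[T_k]$, where $\overline{c}$ are the Skolem constants for $\neg\alpha$; $C$ denotes the set of foreground elements that interpret terms in $T_k$. - *Type-2* for $L=\forall\overline{x}.R(\overline{x})\to\psi(\overline{x})$: a model with finite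 foreground universe of at most $\mathit{size}$ elements (for a fixed bound $\mathit{size}$), satisfying $\mathcal{A}$, interpreting $\mathcal{R}^{\mathrm{rec}}$ by lfp semantics, with a tuple $\overline{c}$ such that $R(\overline{c})\wedge\neg\psi(\overline{c})$ holds. - *Type-3* for $L$: a model of $(\mathrm{ctx}\wedge\neg\mathrm{PFP}(L)[\overline{c}])[T_k]$, where $\overline{c}$ are the Skolem constants for $\neg\mathrm{PFP}(L)$. **Algorithm** $\mathrm{FOSSIL}(\mathcal{A},\mathcal{D},\mathcal{G},\alpha;k,h)$. The choices of counterexamples and of synthesized lemmas may be made by any procedures meeting the following specification. 1. Set $\mathcal{L}:=()$; let the sets of Type-2 and Type-3 counterexamples be empty. 2. (Outer loop) If $\mathrm{SQI}(\bigwedge(\mathcal{A}\cup\mathcal{D}^{\mathrm{fp}}\cup\mathcal{L})\Rightarrow\alpha,\,k)=$ VALID, halt and return $\mathcal{L}$. Otherwise obtain a Type-1 counterexample $M_1$ with set $C$, replacing any previous one. 3. (Inner loop) Ask for a lemma $L=\forall\overline{x}.R(\overline{x})\to\psi(\overline{x})$ in $\mathrm{Lang}(\mathcal{G}_h)$ such that (a) $L$ is false in $M_1$ at some tuple of elements of $C$; (b) $L(\overline{c})$ holds in every stored Type-2 counterexample that was added, with tuple $\overline{c}$, for a lemma with the same antecedent relation $R$; (c) $\mathrm{PFP}(L)(\overline{c})$ holds in every stored Type-3 counterexample that was added, with tuple $\overline{c}$, for a lemma with the same antecedent relation $R$. Such an $L$ is returned whenever one exists. If none exists, call $\mathrm{FOSSIL}(\mathcal{A},\mathcal{D},\mathcal{G},\alpha;k+1,h+1)$.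 4. If $\mathrm{SQI}(\bigwedge(\mathcal{A}\cup\mathcal{D}^{\mathrm{fp}}\cup\mathcal{L})\Rightarrow\mathrm{PFP}(L),\,k)=$ VALID, append $L$ to $\mathcal{L}$, empty the set of Type-3 counterexamples, and go to step 2. 5. Otherwise, search for a Type-2 counterexample for $L$ (of size at most $\mathit{size}$). If one is found, store it, with its tuple and the relation $R$. If none is found, obtain a Type-3 counterexample for $L$ and store it, with its tuple and the relation $R$. Go to step 3. -}

module Defs where

open import Level using (0ℓ; suc)
open import Data.Bool.Base using (Bool; T; if_then_else_)
open import Data.Fin.Base using (Fin; toℕ)
open import Data.List.Base using (List; []; _∷_; _∷ʳ_; _++_; length; lookup; map; take)
open import Data.List.Membership.Propositional using (_∈_)
open import Data.List.Relation.Unary.All as All using (All; []; _∷_)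
open import Data.Nat.Base as ℕ using (ℕ; _≤_; _⊔_)
open import Data.Nat.Properties using () renaming (_≟_ to _≟ℕ_)
open import Data.Product using (Σ; Σ-syntax; ∃; ∃-syntax; _×_; _,_; proj₁; proj₂)
open import Data.Sign.Base using (Sign; opposite)
open import Data.Sum.Base using (_⊎_; inj₁; inj₂)
open import Data.Unit.Base using (⊤)
open import Function.Base using (flip)
open import Function.Bundles using (_↣_; Injection)
open import Induction.WellFounded using (Acc)
open import Relation.Binary.Construct.Closure.ReflexiveTransitive using (Star)
open import Relation.Binary.Definitions using (DecidableEquality)
open import Relation.Binary.PropositionalEquality using (_≡_; refl)
open import Relation.Nullary.Decidable using (Dec; yes; no; via-injection)
open import Relation.Nullary.Negation using (¬_)
open import Relation.Unary using (Pred; _∪_; ｛_｝)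

data Sort (B : Set) : Set where
  fg : Sort B
  bg : B → Sort B

-- The syntax is countable: this is implicit in any decision procedure that
-- takes formulas as input.
record Signature : Set₁ where
  field
    Background   : Set
    Fun          : Set
    Rel          : Set
    dom          : Fun → List (Sort Background)
    cod          : Fun → Sort Background
    arity        : Rel → List (Sort Background)
    isRec        : Rel → Bool
    rec-fg       : ∀ R → T (isRec R) → All (_≡ fg) (arity R)
    constant     : Fun
    constant-dom : dom constant ≡ []
    constant-cod : cod constant ≡ fg
    Background↣ℕ : Background ↣ ℕ
    Fun↣ℕ        : Fun ↣ ℕ
    Rel↣ℕ        : Rel ↣ ℕ

  _≟ᴿ_ : DecidableEquality Rel
  _≟ᴿ_ = via-injection Rel↣ℕ _≟ℕ_

  RecRel : Set
  RecRel = Σ[ R ∈ Rel ] T (isRec R)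

  recArity : RecRel → List (Sort Background)
  recArity (R , _) = arity R

module _ (S : Signature) where
  open Signature S

  -- A context lists the sorts of the free variables.
  Ctx : Set
  Ctx = List (Sort Background)

  Foreground : Ctx → Set
  Foreground = All (_≡ fg)

  data Term (Γ : Ctx) : Sort Background → Set where
    var : ∀ {s} → s ∈ Γ → Term Γ s
    app : (f : Fun) → All (Term Γ) (dom f) → Term Γ (cod f)

  infix  9 _≐_
  infix  8 ∼_
  infixr 7 _∧_
  infixr 6 _∨_
  infixr 5 _⇒_
  infix  4 _⇔_

  -- Quantifier-free formulas.
  data QF (Γ : Ctx) : Set where
    _≐_         : ∀ {s} → Term Γ s → Term Γ s → QF Γ
    rel         : (R : Rel) → All (Term Γ) (arity R) → QF Γ
    ∼_          : QF Γ → QF Γ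
    _∧_ _∨_ _⇒_ : QF Γ → QF Γ → QF Γ

  _⇔_ : ∀ {Γ} → QF Γ → QF Γ → QF Γ
  φ ⇔ ψ = (φ ⇒ ψ) ∧ (ψ ⇒ φ)

  -- Full first-order formulas; only the background theories need them.
  data FO (Γ : Ctx) : Set where
    ⌊_⌋            : QF Γ → FO Γ
    ∼′_            : FO Γ → FO Γ
    _∧′_ _∨′_ _⇒′_ : FO Γ → FO Γ → FO Γ
    ∀′ ∃′          : (s : Sort Background) → FO (s ∷ Γ) → FO Γ

  Subst : Ctx → Ctx → Set
  Subst Γ Δ = All (Term Δ) Γ

  vars : ∀ {Γ} → Subst Γ Γ
  vars = All.tabulate var

  mutual
    subᵗ : ∀ {Γ Δ s} → Subst Γ Δ → Term Γ s → Term Δ s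
    subᵗ τ (var x)    = All.lookup τ x
    subᵗ τ (app f ts) = app f (subᵗˢ τ ts)

    subᵗˢ : ∀ {Γ Δ ss} → Subst Γ Δ → All (Term Γ) ss → All (Term Δ) ss
    subᵗˢ τ []       = []
    subᵗˢ τ (t ∷ ts) = subᵗ τ t ∷ subᵗˢ τ ts

  sub : ∀ {Γ Δ} → Subst Γ Δ → QF Γ → QF Δ
  sub τ (s ≐ t)    = subᵗ τ s ≐ subᵗ τ t
  sub τ (rel R ts) = rel R (subᵗˢ τ ts)
  sub τ (∼ φ)      = ∼ sub τ φ
  sub τ (φ ∧ ψ)    = sub τ φ ∧ sub τ ψ
  sub τ (φ ∨ ψ)    = sub τ φ ∨ sub τ ψ
  sub τ (φ ⇒ ψ)    = sub τ φ ⇒ sub τ ψ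

  -- Variables and constants have depth 0.
  mutual
    depth : ∀ {Γ s} → Term Γ s → ℕ
    depth (var _)    = 0
    depth (app _ ts) = depths ts

    depths : ∀ {Γ ss} → All (Term Γ) ss → ℕ
    depths []       = 0
    depths (t ∷ ts) = ℕ.suc (depth t) ⊔ depths ts

  -- A universal sentence over the foreground sort, given by its matrix.
  record Universal : Set where
    constructor ∀∀
    field
      ctx    : Ctx
      ctx-fg : Foreground ctx
      matrix : QF ctx
  open Universal

  record Structure : Set₁ where
    field
      Carrier   : Sort Background → Set
      inhabited : ∀ s → Carrier s
      ⟦fun⟧     : ∀ f → All Carrier (dom f) → Carrier (cod f)
      ⟦rel⟧     : ∀ R → All Carrier (arity R) → Set
  open Structure

  Env : Structure → Ctx → Set
  Env M = All (Carrier M)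

  module _ (M : Structure) where
    mutual
      eval : ∀ {Γ s} → Env M Γ → Term Γ s → Carrier M s
      eval e (var x)    = All.lookup e x
      eval e (app f ts) = ⟦fun⟧ M f (evals e ts)

      evals : ∀ {Γ ss} → Env M Γ → All (Term Γ) ss → Env M ss
      evals e []       = []
      evals e (t ∷ ts) = eval e t ∷ evals e ts

    Holds : ∀ {Γ} → Env M Γ → QF Γ → Set
    Holds e (s ≐ t)    = eval e s ≡ eval e t
    Holds e (rel R ts) = ⟦rel⟧ M R (evals e ts)
    Holds e (∼ φ)      = ¬ Holds e φ
    Holds e (φ ∧ ψ)    = Holds e φ × Holds e ψ
    Holds e (φ ∨ ψ)    = Holds e φ ⊎ Holds e ψ
    Holds e (φ ⇒ ψ)    = Holds e φ → Holds e ψ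

    HoldsFO : ∀ {Γ} → Env M Γ → FO Γ → Set
    HoldsFO e ⌊ φ ⌋    = Holds e φ
    HoldsFO e (∼′ φ)   = ¬ HoldsFO e φ
    HoldsFO e (φ ∧′ ψ) = HoldsFO e φ × HoldsFO e ψ
    HoldsFO e (φ ∨′ ψ) = HoldsFO e φ ⊎ HoldsFO e ψ
    HoldsFO e (φ ⇒′ ψ) = HoldsFO e φ → HoldsFO e ψ
    HoldsFO e (∀′ s φ) = (x : Carrier M s) → HoldsFO (x ∷ e) φ
    HoldsFO e (∃′ s φ) = Σ[ x ∈ Carrier M s ] HoldsFO (x ∷ e) φ

    True : Universal → Set
    True U = (e : Env M (ctx U)) → Holds e (matrix U)

  module _ (σ : Background) where
    mutual
      Onlyᵗ : ∀ {Γ s} → Term Γ s → Set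
      Onlyᵗ {s = s} (var _) = s ≡ bg σ
      Onlyᵗ (app f ts)      = cod f ≡ bg σ × Onlyᵗˢ ts

      Onlyᵗˢ : ∀ {Γ ss} → All (Term Γ) ss → Set
      Onlyᵗˢ []       = ⊤
      Onlyᵗˢ (t ∷ ts) = Onlyᵗ t × Onlyᵗˢ ts

    -- The second condition on atoms excludes nullary recursive relations.
    OnlyQF : ∀ {Γ} → QF Γ → Set
    OnlyQF (s ≐ t)    = Onlyᵗ s × Onlyᵗ t
    OnlyQF (rel R ts) = Onlyᵗˢ ts × ¬ T (isRec R)
    OnlyQF (∼ φ)      = OnlyQF φ
    OnlyQF (φ ∧ ψ)    = OnlyQF φ × OnlyQF ψ
    OnlyQF (φ ∨ ψ)    = OnlyQF φ × OnlyQF ψ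
    OnlyQF (φ ⇒ ψ)    = OnlyQF φ × OnlyQF ψ

    Only : ∀ {Γ} → FO Γ → Set
    Only ⌊ φ ⌋    = OnlyQF φ
    Only (∼′ φ)   = Only φ
    Only (φ ∧′ ψ) = Only φ × Only ψ
    Only (φ ∨′ ψ) = Only φ × Only ψ
    Only (φ ⇒′ ψ) = Only φ × Only ψ
    Only (∀′ s φ) = s ≡ bg σ × Only φ
    Only (∃′ s φ) = s ≡ bg σ × Only φ

  record Theories : Set₁ where
    field
      axioms : (σ : Background) → Pred (FO []) 0ℓ
      only   : ∀ {σ φ} → axioms σ φ → Only σ φ

  -- OccursRec p φ: recursive relations occur in φ only with polarity p.
  OccursRec : ∀ {Γ} → Sign → QF Γ → Set
  OccursRec p        (s ≐ t)    = ⊤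
  OccursRec Sign.+   (rel R ts) = ⊤
  OccursRec Sign.-   (rel R ts) = ¬ T (isRec R)
  OccursRec p        (∼ φ)      = OccursRec (opposite p) φ
  OccursRec p        (φ ∧ ψ)    = OccursRec p φ × OccursRec p ψ
  OccursRec p        (φ ∨ ψ)    = OccursRec p φ × OccursRec p ψ
  OccursRec p        (φ ⇒ ψ)    = OccursRec (opposite p) φ × OccursRec p ψ

  record Definitions : Set where
    field
      body     : (R : RecRel) → QF (recArity R)
      positive : ∀ R → OccursRec Sign.+ (body R)

  record Lemma : Set where
    constructor _⊃_
    field
      antecedent : RecRel
      consequent : QF (recArity antecedent)
  open Lemma

  lemma : Lemma → Universal
  lemma ((R , r) ⊃ ψ) = ∀∀ (arity R) (rec-fg R r) (rel R vars ⇒ ψ)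

  -- Replaces every atom R(t̄) by ψ(t̄) ∧ R(t̄).
  strengthen : (R : Rel) → QF (arity R) → ∀ {Γ} → QF Γ → QF Γ
  strengthen R ψ (s ≐ t)     = s ≐ t
  strengthen R ψ (rel R′ ts) with R ≟ᴿ R′
  ... | yes refl = sub ts ψ ∧ rel R ts
  ... | no _     = rel R′ ts
  strengthen R ψ (∼ φ)       = ∼ strengthen R ψ φ
  strengthen R ψ (φ ∧ χ)     = strengthen R ψ φ ∧ strengthen R ψ χ
  strengthen R ψ (φ ∨ χ)     = strengthen R ψ φ ∨ strengthen R ψ χ
  strengthen R ψ (φ ⇒ χ)     = strengthen R ψ φ ⇒ strengthen R ψ χ

  -- A context-free grammar over an alphabet in which lemmas are written
  -- unambiguously.
  record Grammar : Set₁ where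
    field
      Token        : Set
      print        : Lemma ↣ List Token
      nonterminals : ℕ
      rules        : Fin nonterminals → List (List (Token ⊎ Fin nonterminals))
      start        : Fin nonterminals

  module _ (G : Grammar) where
    open Grammar G
    open Injection print using () renaming (to to printed)

    mutual
      data ParseTree (A : Fin nonterminals) : Set where
        node : ∀ {rhs} → rhs ∈ rules A → Forest rhs → ParseTree A

      data Forest : List (Token ⊎ Fin nonterminals) → Set where
        []   : Forest []
        leaf : ∀ {rhs} (a : Token) → Forest rhs → Forest (inj₁ a ∷ rhs)
        _∷_  : ∀ {A rhs} → ParseTree A → Forest rhs → Forest (inj₂ A ∷ rhs)

    mutual
      yield : ∀ {A} → ParseTree A → List Token
      yield (node _ ts) = yields ts

      yields : ∀ {rhs} → Forest rhs → List Token
      yields []          = []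
      yields (leaf a ts) = a ∷ yields ts
      yields (t ∷ ts)    = yield t ++ yields ts

    mutual
      height : ∀ {A} → ParseTree A → ℕ
      height (node _ ts) = ℕ.suc (heights ts)

      heights : ∀ {rhs} → Forest rhs → ℕ
      heights []          = 0
      heights (leaf _ ts) = heights ts
      heights (t ∷ ts)    = height t ⊔ heights ts

    Lang : Pred Lemma 0ℓ
    Lang L = Σ[ t ∈ ParseTree start ] yield t ≡ printed L

    LangUpTo : ℕ → Pred Lemma 0ℓ
    LangUpTo h L = Σ[ t ∈ ParseTree start ] yield t ≡ printed L × height t ≤ h

  module _ (𝒯 : Theories) where
    open Theories 𝒯

    Model : Structure → Set
    Model M = ∀ {σ φ} → axioms σ φ → HoldsFO M [] φ

    infix 4 _⊨_
    _⊨_ : Pred Universal 0ℓ → Universal → Set₁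
    Ψ ⊨ U = ∀ M → Model M → (∀ {V} → Ψ V → True M V) → True M U

    -- Fresh constants are represented by free variables, so a structure for
    -- the signature extended by constants Δ is a structure with an environment
    -- for Δ, and a ground term over that signature is a term in context Δ.
    record Pointed (Δ : Ctx) : Set₁ where
      constructor _at_
      field
        structure : Structure
        point     : Env structure Δ
    open Pointed

    infix 4 _satisfies_
    _satisfies_ : ∀ {Δ} → Pointed Δ → Pred (QF Δ) 0ℓ → Set
    (M at c) satisfies Φ = Model M × (∀ {φ} → Φ φ → Holds M c φ)

    Satisfiable : ∀ {Δ} → Pred (QF Δ) 0ℓ → Set₁
    Satisfiable {Δ} Φ = Σ[ P ∈ Pointed Δ ] P satisfies Φ

    QFDecidable : Set₁
    QFDecidable = ∀ {Δ} (φ : QF Δ) → Dec (Satisfiable ｛ φ ｝)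

    TermsUpTo : ℕ → (Δ : Ctx) → Sort Background → Set
    TermsUpTo k Δ s = Σ[ t ∈ Term Δ s ] depth t ≤ k

    _[T_] : Pred Universal 0ℓ → ℕ → ∀ {Δ} → Pred (QF Δ) 0ℓ
    (Ψ [T k ]) {Δ} φ =
      Σ[ U ∈ Universal ] Ψ U ×
      Σ[ ts ∈ All (TermsUpTo k Δ) (ctx U) ] φ ≡ sub (All.map proj₁ ts) (matrix U)

    -- The instances (⋀ Ψ ∧ ¬ U[c̄])[T_k], where c̄ are Skolem constants for the
    -- variables of U.
    refutation : Pred Universal 0ℓ → (U : Universal) → ℕ → Pred (QF (ctx U)) 0ℓ
    refutation Ψ U k = Ψ [T k ] ∪ ｛ ∼ matrix U ｝

    -- SQI(⋀ Ψ ⇒ U, k) = VALID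
    Valid : Pred Universal 0ℓ → Universal → ℕ → Set₁
    Valid Ψ U k = ¬ Satisfiable (refutation Ψ U k)

    module _ (D : Definitions) where
      open Definitions D

      fixpoint : RecRel → Universal
      fixpoint (R , r) = ∀∀ (arity R) (rec-fg R r) (rel R vars ⇔ body (R , r))

      PFP : Lemma → Universal
      PFP ((R , r) ⊃ ψ) = ∀∀ (arity R) (rec-fg R r) (strengthen R ψ (body (R , r)) ⇒ ψ)

      -- The values of I at non-recursive relations are ignored.
      reinterpret : (M : Structure) → (∀ R → Pred (Env M (arity R)) 0ℓ) → Structure
      reinterpret M I = record M
        { ⟦rel⟧ = λ R xs → if isRec R then I R xs else ⟦rel⟧ M R xs }

      LFP : Structure → Set₁
      LFP M =
        (∀ R → True M (fixpoint R)) ×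
        (∀ I → (∀ R → True (reinterpret M I) (fixpoint R)) →
         ∀ R → T (isRec R) → ∀ {xs} → ⟦rel⟧ M R xs → I R xs)

      module _ (A : List Universal) where

        -- A ∪ D^fp ∪ Ls
        context : List Lemma → Pred Universal 0ℓ
        context Ls U = U ∈ A ⊎ (∃[ R ] U ≡ fixpoint R) ⊎ U ∈ map lemma Ls

        ProvableByIndependentLemmas : Grammar → Universal → Set₁
        ProvableByIndependentLemmas G α =
          Σ[ Ls ∈ List Lemma ]
            All (Lang G) Ls × (context Ls ⊨ α) × (∀ {L} → L ∈ Ls → context [] ⊨ PFP L)

        Proves : List Lemma → Universal → Set₁
        Proves Ls α =
          (context Ls ⊨ α) ×
          (∀ i → context (take (toℕ i) Ls) ⊨ PFP (lookup Ls i))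

        module _ (G : Grammar) (α : Universal) (size : ℕ) where

          -- A counterexample to a lemma with antecedent R, stored with its tuple.
          Stored : Set₁
          Stored = Σ[ R ∈ RecRel ] Pointed (recArity R)

          Type1 : ℕ → List Lemma → Pointed (ctx α) → Set
          Type1 k Ls P = P satisfies refutation (context Ls) α k

          Type2 : (L : Lemma) → Pointed (recArity (antecedent L)) → Set₁
          Type2 ((R , _) ⊃ ψ) (M at c) =
            Model M × (Carrier M fg ↣ Fin size) × (∀ {U} → U ∈ A → True M U) ×
            LFP M × ⟦rel⟧ M R c × ¬ Holds M c ψ

          Type3 : ℕ → List Lemma → (L : Lemma) → Pointed (recArity (antecedent L)) → Set
          Type3 k Ls L P = P satisfies refutation (context Ls) (PFP L) k

          -- The elements that interpret terms in T_k.
          Named : ℕ → ∀ {Δ} → Pointed Δ → Sort Background → Set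
          Named k {Δ} (M at c) s =
            Σ[ x ∈ Carrier M s ] Σ[ t ∈ TermsUpTo k Δ s ] eval M c (proj₁ t) ≡ x

          record Candidate (k h : ℕ) (M₁ : Pointed (ctx α)) (T2 T3 : List Stored)
                           (L : Lemma) : Set₁ where
            field
              inLanguage : LangUpTo G h L
              falseInM₁  : Σ[ xs ∈ All (Named k M₁) (recArity (antecedent L)) ]
                           ¬ Holds (structure M₁) (All.map proj₁ xs) (matrix (lemma L))
              respectsT2 : ∀ {M c} → (antecedent L , (M at c)) ∈ T2 →
                           Holds M c (matrix (lemma L))
              respectsT3 : ∀ {M c} → (antecedent L , (M at c)) ∈ T3 →
                           Holds M c (matrix (PFP L))

          data State : Set₁ where
            outer : (k h : ℕ) (Ls : List Lemma) (T2 T3 : List Stored) → State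
            inner : (k h : ℕ) (Ls : List Lemma) (M₁ : Pointed (ctx α))
                    (T2 T3 : List Stored) → State
            check : (k h : ℕ) (Ls : List Lemma) (M₁ : Pointed (ctx α))
                    (T2 T3 : List Stored) (L : Lemma) → State
            done  : List Lemma → State

          initial : (k h : ℕ) → State
          initial k h = outer k h [] [] []

          -- The nondeterminism ranges over everything the procedures choosing
          -- counterexamples and lemmas may answer. The search for Type-2
          -- counterexamples is not assumed complete: it may fail to find any
          -- even if one exists.
          infix 4 _⟶_
          data _⟶_ : State → State → Set₁ where

            return : ∀ {k h Ls T2 T3} →
              Valid (context Ls) α k →
              outer k h Ls T2 T3 ⟶ done Ls

            type1 : ∀ {k h Ls T2 T3 M₁} →
              ¬ Valid (context Ls) α k → Type1 k Ls M₁ →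
              outer k h Ls T2 T3 ⟶ inner k h Ls M₁ T2 T3

            propose : ∀ {k h Ls M₁ T2 T3 L} →
              Candidate k h M₁ T2 T3 L →
              inner k h Ls M₁ T2 T3 ⟶ check k h Ls M₁ T2 T3 L

            restart : ∀ {k h Ls M₁ T2 T3} →
              (∀ L → ¬ Candidate k h M₁ T2 T3 L) →
              inner k h Ls M₁ T2 T3 ⟶ initial (ℕ.suc k) (ℕ.suc h)

            accept : ∀ {k h Ls M₁ T2 T3 L} →
              Valid (context Ls) (PFP L) k →
              check k h Ls M₁ T2 T3 L ⟶ outer k h (Ls ∷ʳ L) T2 []

            type2 : ∀ {k h Ls M₁ T2 T3 L P} →
              ¬ Valid (context Ls) (PFP L) k → Type2 L P →
              check k h Ls M₁ T2 T3 L ⟶ inner k h Ls M₁ ((antecedent L , P) ∷ T2) T3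

            type3 : ∀ {k h Ls M₁ T2 T3 L P} →
              ¬ Valid (context Ls) (PFP L) k → Type3 k Ls L P →
              check k h Ls M₁ T2 T3 L ⟶ inner k h Ls M₁ T2 ((antecedent L , P) ∷ T3)

          -- No run is infinite, and every run that cannot be continued has
          -- returned a sequence of lemmas that satisfies Q.
          TerminatesWith : Pred (List Lemma) (suc 0ℓ) → State → Set₁
          TerminatesWith Q s =
            Acc (flip _⟶_) s ×
            (∀ {s′} → Star _⟶_ s s′ → (∀ s″ → ¬ s′ ⟶ s″) →
             Σ[ Ls ∈ List Lemma ] s′ ≡ done Ls × Q Ls)

{-# OPTIONS --safe #-}
-- Compactness and Herbrand's theorem give a k at which the target lemmas prove α and each PFP(L_i) is
-- provable from A ∪ D^fp alone; take h large enough for the L_i. By fixpoint induction a target lemma holds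
-- in every Type-2 counterexample, and by the choice of k its PFP holds at every Type-3 counterexample, so
-- counterexamples never exclude a target lemma. If all of them held on the named elements of the Type-1
-- model, that model would contradict the validity of α at depth k; hence some target lemma is always a
-- candidate and FOSSIL never restarts. Every rejected lemma is excluded by its counterexample, and every
-- accepted one is new because the Type-1 model satisfies the lemmas already accepted. As Lang(G_h) is
-- finite, the pair (lemmas not accepted, lemmas not refuted) decreases lexicographically.
--
-- For compactness no ultrafilter on ℕ is needed: only countably many sets {n | M_n ⊨ φ(names)} matter, and
-- a decreasing sequence of infinite sets of indices decides them one by one. The reduced product is built on
-- Henkin names, with the name of least code representing its class, since Agda has no quotients.
module Submission where

open import Defs
open import Level using (0ℓ; suc; Lift; lift; lower)
open import Axiom.DoubleNegationElimination using (em⇒dne)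
open import Axiom.ExcludedMiddle using (ExcludedMiddle)
open import Axiom.UniquenessOfIdentityProofs.WithK using (uip)
open import Data.Bool.Base using (T; true; false; if_then_else_)
open import Data.Bool.Properties using (T-irrelevant)
open import Data.Fin.Base using (Fin; toℕ)
open import Data.List.Base using (List; []; _∷_; _∷ʳ_; _++_; length; lookup; map; take; filter; concatMap; cartesianProductWith)
open import Data.List.Membership.Propositional using (_∈_; _∉_)
open import Data.List.Membership.Propositional.Properties using (∈-map⁺; ∈-map⁻; ∈-concatMap⁺; ∈-cartesianProductWith⁺; ∈-++⁺ˡ; ∈-++⁺ʳ)
open import Data.List.Relation.Unary.All as All using (All; []; _∷_)
open import Data.List.Relation.Unary.All.Properties using (lookup-map; map-∘)
open import Data.List.Relation.Unary.Any as Any using (here; there)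
open import Data.Nat.Base as ℕ using (ℕ; zero; _+_; _*_; _≤_; _<_; _⊔_; _≤′_; ≤′-refl; ≤′-step; z≤n; s≤s)
open import Data.Nat.Properties
open import Data.Product using (Σ; Σ-syntax; ∃; ∃-syntax; _×_; _,_; proj₁; proj₂)
open import Data.Product.Function.NonDependent.Propositional using (_×-⇔_)
open import Data.Sign.Base using (Sign)
open import Data.Sum.Base as Sum using (_⊎_; inj₁; inj₂; [_,_]′)
open import Data.Sum.Function.Propositional using (_⊎-⇔_)
open import Data.Unit.Base using (⊤; tt)
open import Function.Base using (_∘_; id; flip)
open import Function.Bundles using (Injection; Equivalence; mk⇔) renaming (_⇔_ to _⟺_)
open import Function.Construct.Composition using (_⇔-∘_)
open import Function.Related.Propositional using (≡⇒)
open import Function.Related.TypeIsomorphisms using (→-cong-⇔; ¬-cong-⇔)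
open import Induction.WellFounded using (Acc; acc)
open import Relation.Binary.Construct.Closure.ReflexiveTransitive using (Star; ε; _◅_)
open import Relation.Binary.PropositionalEquality using (_≡_; refl; sym; trans; cong; cong₂; subst)
open import Relation.Nullary.Decidable using (Dec; yes; no; map′; toWitness; fromWitness) renaming (True to IsYes)
open import Relation.Nullary.Negation using (¬_; contradiction)
open import Relation.Unary using (Pred)

-- Classical principles, and a filter deciding countably many sets

module Classical (em : ExcludedMiddle (suc 0ℓ)) where

  dec : (P : Set) → Dec P
  dec P = map′ lower lift (em {Lift (suc 0ℓ) P})

  dne : {P : Set₁} → ¬ ¬ P → P
  dne = em⇒dne em

  dne₀ : {P : Set} → ¬ ¬ P → P
  dne₀ ¬¬p = lower (dne {Lift _ _} (λ ¬p → ¬¬p (¬p ∘ lift)))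

  ¬∀⇒∃¬ : {A : Set} {P : A → Set} → ¬ (∀ x → P x) → ∃[ x ] ¬ P x
  ¬∀⇒∃¬ ¬∀ = dne₀ λ ¬∃ → ¬∀ λ x → dne₀ λ ¬p → ¬∃ (x , ¬p)

  opaque
    least : (P : Pred ℕ 0ℓ) → ∃ P → ∃[ j ] P j × (∀ i → P i → j ≤ i)
    least P (m , p) = search m 0 (subst P (sym (+-identityʳ m)) p) λ _ ()
      where
      -- `d` is fuel: a witness lies `d` steps above `j`, and everything below `j` has been ruled
      -- out.
      search : ∀ d j → P (d + j) → (∀ i → i < j → ¬ P i) → ∃[ j ] P j × (∀ i → P i → j ≤ i)
      search d j p below with dec (P j)
      ... | yes q = j , q , λ i pi → ≮⇒≥ λ i<j → below i i<j pi
      search zero j p below    | no ¬q = contradiction p ¬q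
      search (ℕ.suc d) j p below | no ¬q =
        search d (ℕ.suc j) (subst P (sym (+-suc d j)) p) λ i i<1+j pi →
          [ (λ i<j → below i i<j pi) , (λ { refl → ¬q pi }) ]′ (m≤n⇒m<n∨m≡n (≤-pred i<1+j))

  module _ (P : ℕ → Pred ℕ 0ℓ) where

    Infinite : Pred ℕ 0ℓ → Set
    Infinite X = ∀ N → ∃[ n ] N ≤ n × X n

    choose : Pred ℕ 0ℓ → Pred ℕ 0ℓ → Pred ℕ 0ℓ
    choose X Y n with dec (Infinite (λ m → X m × Y m))
    ... | yes _ = Y n
    ... | no _  = ¬ Y n

    stage : ℕ → Pred ℕ 0ℓ
    stage zero      n = ⊤
    stage (ℕ.suc i) n = stage i n × choose (stage i) (P i) n

    stage-infinite : ∀ i → Infinite (stage i)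
    stage-infinite zero N = N , ≤-refl , tt
    stage-infinite (ℕ.suc i) with dec (Infinite (λ m → stage i m × P i m))
    ... | yes inf = inf
    -- From `N₀` on no element of the stage lies in `P i`, so a late element of the stage lies in
    -- the complement.
    ... | no ¬inf = λ N →
      let N₀ , fin       = ¬∀⇒∃¬ ¬inf
          n , N⊔N₀≤n , s = stage-infinite i (N ⊔ N₀)
      in n , ≤-trans (m≤m⊔n N N₀) N⊔N₀≤n , s ,
         λ p → fin (n , ≤-trans (m≤n⊔m N N₀) N⊔N₀≤n , s , p)

    stage-antitone : ∀ {i j n} → i ≤′ j → stage j n → stage i n
    stage-antitone ≤′-refl       s = s
    stage-antitone (≤′-step i≤j) s = stage-antitone i≤j (proj₁ s)

    -- A proper filter on ℕ that contains the cofinite sets and decides every P i.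
    record Large (X : Pred ℕ 0ℓ) : Set where
      constructor from-stage
      field
        index : ℕ
        holds : ∀ n → index ≤ n → stage index n → X n

    large-mono : ∀ {X Y : Pred ℕ 0ℓ} → (∀ n → X n → Y n) → Large X → Large Y
    large-mono X⊆Y (from-stage i x) = from-stage i λ n i≤n s → X⊆Y n (x n i≤n s)

    large-∩ : ∀ {X Y} → Large X → Large Y → Large (λ n → X n × Y n)
    large-∩ (from-stage i x) (from-stage j y) = from-stage (i ⊔ j) λ n i⊔j≤n s →
      x n (≤-trans (m≤m⊔n i j) i⊔j≤n) (stage-antitone (≤⇒≤′ (m≤m⊔n i j)) s) ,
      y n (≤-trans (m≤n⊔m i j) i⊔j≤n) (stage-antitone (≤⇒≤′ (m≤n⊔m i j)) s)

    large-cofinite : ∀ {X : Pred ℕ 0ℓ} N → (∀ n → N ≤ n → X n) → Large X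
    large-cofinite N x = from-stage N λ n N≤n _ → x n N≤n

    large-inhabited : ∀ {X} → Large X → ∃ X
    large-inhabited (from-stage i x) = let n , i≤n , s = stage-infinite i i in n , x n i≤n s

    large-decides : ∀ i → Large (P i) ⊎ Large (λ n → ¬ P i n)
    large-decides i with dec (Infinite (λ m → stage i m × P i m)) in eq
    ... | yes _ = inj₁ (from-stage (ℕ.suc i) λ n _ s → chosen n (proj₂ s))
      where
      chosen : ∀ n → choose (stage i) (P i) n → P i n
      chosen n c rewrite eq = c
    ... | no _  = inj₂ (from-stage (ℕ.suc i) λ n _ s → chosen n (proj₂ s))
      where
      chosen : ∀ n → choose (stage i) (P i) n → ¬ P i n
      chosen n c rewrite eq = c

    -- Takes over the role of maximality of an ultrafilter: negation, implication and disjunction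
    -- pass through `Large` when their first component is decided.
    Decided : Pred ℕ 0ℓ → Set
    Decided X = Large X ⊎ Large (λ n → ¬ X n)

    large-absurd : ∀ {X} → Large X → ¬ Large (λ n → ¬ X n)
    large-absurd x ¬x = let _ , p , ¬p = large-inhabited (large-∩ x ¬x) in ¬p p

    large-× : ∀ {X Y} → (Large X × Large Y) ⟺ Large (λ n → X n × Y n)
    large-× = mk⇔ (λ (x , y) → large-∩ x y)
      λ xy → large-mono (λ _ → proj₁) xy , large-mono (λ _ → proj₂) xy

    large-→ : ∀ {X Y : Pred ℕ 0ℓ} → Decided X → (Large X → Large Y) ⟺ Large (λ n → X n → Y n)
    large-→ {X} {Y} X? = mk⇔ (λ f → [ (λ x → large-mono (λ _ y _ → y) (f x))
                                    , large-mono (λ _ ¬x x → contradiction x ¬x) ]′ X?)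
      λ f x → large-mono (λ _ (g , y) → g y) (large-∩ f x)

    large-¬ : ∀ {X : Pred ℕ 0ℓ} → Decided X → (¬ Large X) ⟺ Large (λ n → ¬ X n)
    large-¬ X? = mk⇔ (λ ¬x → [ (λ x → contradiction x ¬x) , id ]′ X?) λ ¬x x → large-absurd x ¬x

    large-⊎ : ∀ {X Y : Pred ℕ 0ℓ} → Decided X → (Large X ⊎ Large Y) ⟺ Large (λ n → X n ⊎ Y n)
    large-⊎ {X} {Y} X? = mk⇔ [ large-mono (λ _ → inj₁) , large-mono (λ _ → inj₂) ]′ split
      where
      split : Large (λ n → X n ⊎ Y n) → Large X ⊎ Large Y
      split xy = [ inj₁ , (λ ¬x → inj₂ (large-mono
        (λ _ (p , q) → [ (λ x → contradiction x q) , id ]′ p) (large-∩ xy ¬x))) ]′ X?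

-- Injective coding of the syntax in ℕ

opaque
  -- This is 2^a (2b + 1); parity separates the power of two from the odd factor.
  pair : ℕ → ℕ → ℕ
  pair zero      b = ℕ.suc (2 * b)
  pair (ℕ.suc a) b = 2 * pair a b

  pair-injective : ∀ {a b c d} → pair a b ≡ pair c d → a ≡ c × b ≡ d
  pair-injective {zero} {b} {zero} {d} eq = refl , *-cancelˡ-≡ b d 2 (suc-injective eq)
  pair-injective {zero} {b} {ℕ.suc c} {d} eq = contradiction (sym eq) (even≢odd (pair c d) b)
  pair-injective {ℕ.suc a} {b} {zero} {d} eq = contradiction eq (even≢odd (pair a b) d)
  pair-injective {ℕ.suc a} {b} {ℕ.suc c} {d} eq =
    let a≡c , b≡d = pair-injective {a} (*-cancelˡ-≡ (pair a b) (pair c d) 2 eq)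
    in cong ℕ.suc a≡c , b≡d

module Syntax (S : Signature) where
  open Signature S

  open Injection Background↣ℕ using () renaming (to to bgCode; injective to bgCode-injective)
  open Injection Fun↣ℕ using () renaming (to to funCode; injective to funCode-injective)
  open Injection Rel↣ℕ using () renaming (to to relCode; injective to relCode-injective)

  codeˢ : Sort Background → ℕ
  codeˢ fg     = 0
  codeˢ (bg σ) = ℕ.suc (bgCode σ)

  codeˢ-injective : ∀ s t → codeˢ s ≡ codeˢ t → s ≡ t
  codeˢ-injective fg     fg     _  = refl
  codeˢ-injective (bg _) (bg _) eq = cong bg (bgCode-injective (suc-injective eq))

  codeᶜ : Ctx S → ℕ
  codeᶜ []      = 0
  codeᶜ (s ∷ Γ) = ℕ.suc (pair (codeˢ s) (codeᶜ Γ))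

  codeᶜ-injective : ∀ Γ Δ → codeᶜ Γ ≡ codeᶜ Δ → Γ ≡ Δ
  codeᶜ-injective []      []      _  = refl
  codeᶜ-injective (s ∷ Γ) (t ∷ Δ) eq =
    let s≡t , Γ≡Δ = pair-injective (suc-injective eq)
    in cong₂ _∷_ (codeˢ-injective s t s≡t) (codeᶜ-injective Γ Δ Γ≡Δ)

  position : ∀ {Γ : Ctx S} {s} → s ∈ Γ → ℕ
  position (here _)  = 0
  position (there x) = ℕ.suc (position x)

  position-injective : ∀ {Γ : Ctx S} {s t} (x : s ∈ Γ) (y : t ∈ Γ) →
    position x ≡ position y → (s , x) ≡ (t , y)
  position-injective (here refl) (here refl) _ = refl
  position-injective (there x) (there y) eq with refl ← position-injective x y (suc-injective eq) = refl

  mutual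
    -- With the tag of the constructor coded apart from the arguments, mixed cases of injectivity
    -- disappear because distinct numerals are never equal.
    codeᵗ : ∀ {Γ s} → Term S Γ s → ℕ
    codeᵗ t = pair (tagᵗ t) (argsᵗ t)

    tagᵗ : ∀ {Γ s} → Term S Γ s → ℕ
    tagᵗ (var _)   = 0
    tagᵗ (app _ _) = 1

    argsᵗ : ∀ {Γ s} → Term S Γ s → ℕ
    argsᵗ (var x)    = position x
    argsᵗ (app f ts) = pair (funCode f) (codeᵗˢ ts)

    codeᵗˢ : ∀ {Γ ss} → All (Term S Γ) ss → ℕ
    codeᵗˢ []       = 0
    codeᵗˢ (t ∷ ts) = pair (codeᵗ t) (codeᵗˢ ts)

  mutual
    -- The code of an equation does not record the sort of its two sides, so the code of a term has
    -- to determine the sort as well; hence the equality in the sum over sorts.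
    codeᵗ-injective : ∀ {Γ s s′} (t : Term S Γ s) (u : Term S Γ s′) →
      codeᵗ t ≡ codeᵗ u → _≡_ {A = ∃ (Term S Γ)} (s , t) (s′ , u)
    codeᵗ-injective t u eq = let tags , args = pair-injective eq in argsᵗ-injective t u tags args

    argsᵗ-injective : ∀ {Γ s s′} (t : Term S Γ s) (u : Term S Γ s′) →
      tagᵗ t ≡ tagᵗ u → argsᵗ t ≡ argsᵗ u → _≡_ {A = ∃ (Term S Γ)} (s , t) (s′ , u)
    argsᵗ-injective (var x) (var y) _ eq with refl ← position-injective x y eq = refl
    argsᵗ-injective (app f ts) (app g us) _ eq
      with f≡g , ts≡us ← pair-injective eq
      with refl ← funCode-injective f≡g
      with refl ← codeᵗˢ-injective ts us ts≡us = refl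

    codeᵗˢ-injective : ∀ {Γ ss} (ts us : All (Term S Γ) ss) → codeᵗˢ ts ≡ codeᵗˢ us → ts ≡ us
    codeᵗˢ-injective []       []       _  = refl
    codeᵗˢ-injective (t ∷ ts) (u ∷ us) eq
      with t≡u , ts≡us ← pair-injective eq
      with refl ← codeᵗ-injective t u t≡u = cong (t ∷_) (codeᵗˢ-injective ts us ts≡us)

  mutual
    codeQ : ∀ {Γ} → QF S Γ → ℕ
    codeQ φ = pair (tagQ φ) (argsQ φ)

    tagQ : ∀ {Γ} → QF S Γ → ℕ
    tagQ (_ ≐ _)   = 0
    tagQ (rel _ _) = 1
    tagQ (∼ _)     = 2
    tagQ (_ ∧ _)   = 3
    tagQ (_ ∨ _)   = 4
    tagQ (_ ⇒ _)   = 5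

    argsQ : ∀ {Γ} → QF S Γ → ℕ
    argsQ (s ≐ t)    = pair (codeᵗ s) (codeᵗ t)
    argsQ (rel R ts) = pair (relCode R) (codeᵗˢ ts)
    argsQ (∼ φ)      = codeQ φ
    argsQ (φ ∧ ψ)    = pair (codeQ φ) (codeQ ψ)
    argsQ (φ ∨ ψ)    = pair (codeQ φ) (codeQ ψ)
    argsQ (φ ⇒ ψ)    = pair (codeQ φ) (codeQ ψ)

  mutual
    codeQ-injective : ∀ {Γ} (φ ψ : QF S Γ) → codeQ φ ≡ codeQ ψ → φ ≡ ψ
    codeQ-injective φ ψ eq = let tags , args = pair-injective eq in argsQ-injective φ ψ tags args

    argsQ-injective : ∀ {Γ} (φ ψ : QF S Γ) → tagQ φ ≡ tagQ ψ → argsQ φ ≡ argsQ ψ → φ ≡ ψ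
    argsQ-injective (s ≐ t) (s′ ≐ t′) _ eq
      with p , q ← pair-injective eq
      with refl ← codeᵗ-injective s s′ p
      with refl ← codeᵗ-injective t t′ q = refl
    argsQ-injective (rel R ts) (rel Q us) _ eq
      with p , q ← pair-injective eq
      with refl ← relCode-injective p = cong (rel R) (codeᵗˢ-injective ts us q)
    argsQ-injective (∼ φ) (∼ ψ) _ eq = cong ∼_ (codeQ-injective φ ψ eq)
    argsQ-injective (φ ∧ χ) (ψ ∧ ω) _ eq =
      let p , q = pair-injective eq in cong₂ _∧_ (codeQ-injective φ ψ p) (codeQ-injective χ ω q)
    argsQ-injective (φ ∨ χ) (ψ ∨ ω) _ eq =
      let p , q = pair-injective eq in cong₂ _∨_ (codeQ-injective φ ψ p) (codeQ-injective χ ω q)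
    argsQ-injective (φ ⇒ χ) (ψ ⇒ ω) _ eq =
      let p , q = pair-injective eq in cong₂ _⇒_ (codeQ-injective φ ψ p) (codeQ-injective χ ω q)

  mutual
    codeF : ∀ {Γ} → FO S Γ → ℕ
    codeF φ = pair (tagF φ) (argsF φ)

    tagF : ∀ {Γ} → FO S Γ → ℕ
    tagF ⌊ _ ⌋    = 0
    tagF (∼′ _)   = 1
    tagF (_ ∧′ _) = 2
    tagF (_ ∨′ _) = 3
    tagF (_ ⇒′ _) = 4
    tagF (∀′ _ _) = 5
    tagF (∃′ _ _) = 6

    argsF : ∀ {Γ} → FO S Γ → ℕ
    argsF ⌊ φ ⌋    = codeQ φ
    argsF (∼′ φ)   = codeF φ
    argsF (φ ∧′ ψ) = pair (codeF φ) (codeF ψ)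
    argsF (φ ∨′ ψ) = pair (codeF φ) (codeF ψ)
    argsF (φ ⇒′ ψ) = pair (codeF φ) (codeF ψ)
    argsF (∀′ s φ) = pair (codeˢ s) (codeF φ)
    argsF (∃′ s φ) = pair (codeˢ s) (codeF φ)

  mutual
    codeF-injective : ∀ {Γ} (φ ψ : FO S Γ) → codeF φ ≡ codeF ψ → φ ≡ ψ
    codeF-injective φ ψ eq = let tags , args = pair-injective eq in argsF-injective φ ψ tags args

    argsF-injective : ∀ {Γ} (φ ψ : FO S Γ) → tagF φ ≡ tagF ψ → argsF φ ≡ argsF ψ → φ ≡ ψ
    argsF-injective ⌊ φ ⌋ ⌊ ψ ⌋ _ eq = cong ⌊_⌋ (codeQ-injective φ ψ eq)
    argsF-injective (∼′ φ) (∼′ ψ) _ eq = cong ∼′_ (codeF-injective φ ψ eq)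
    argsF-injective (φ ∧′ χ) (ψ ∧′ ω) _ eq =
      let p , q = pair-injective eq in cong₂ _∧′_ (codeF-injective φ ψ p) (codeF-injective χ ω q)
    argsF-injective (φ ∨′ χ) (ψ ∨′ ω) _ eq =
      let p , q = pair-injective eq in cong₂ _∨′_ (codeF-injective φ ψ p) (codeF-injective χ ω q)
    argsF-injective (φ ⇒′ χ) (ψ ⇒′ ω) _ eq =
      let p , q = pair-injective eq in cong₂ _⇒′_ (codeF-injective φ ψ p) (codeF-injective χ ω q)
    argsF-injective (∀′ s φ) (∀′ t ψ) _ eq
      with p , q ← pair-injective eq
      with refl ← codeˢ-injective s t p = cong (∀′ s) (codeF-injective φ ψ q)
    argsF-injective (∃′ s φ) (∃′ t ψ) _ eq
      with p , q ← pair-injective eq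
      with refl ← codeˢ-injective s t p = cong (∃′ s) (codeF-injective φ ψ q)

  -- Ground terms over the Skolem constants Δ, closed under Henkin witnesses for x in φ(x, ns).
  data Name (Δ : Ctx S) : Sort Background → Set where
    pt  : ∀ {s} → s ∈ Δ → Name Δ s
    app : (f : Fun) → All (Name Δ) (dom f) → Name Δ (cod f)
    wit : ∀ {Γ s} → FO S (s ∷ Γ) → All (Name Δ) Γ → Name Δ s

  module _ {Δ : Ctx S} where

    mutual
      codeᴺ : ∀ {s} → Name Δ s → ℕ
      codeᴺ n = pair (tagᴺ n) (argsᴺ n)

      tagᴺ : ∀ {s} → Name Δ s → ℕ
      tagᴺ (pt _)    = 0
      tagᴺ (app _ _) = 1
      tagᴺ (wit _ _) = 2

      argsᴺ : ∀ {s} → Name Δ s → ℕ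
      argsᴺ (pt x)             = position x
      argsᴺ (app f ns)         = pair (funCode f) (codeᴺˢ ns)
      -- The context is coded first because formula codes are shown injective within one fixed
      -- context.
      argsᴺ (wit {Γ} {s} φ ns) = pair (codeᶜ (s ∷ Γ)) (pair (codeF φ) (codeᴺˢ ns))

      codeᴺˢ : ∀ {ss} → All (Name Δ) ss → ℕ
      codeᴺˢ []       = 0
      codeᴺˢ (n ∷ ns) = pair (codeᴺ n) (codeᴺˢ ns)

    mutual
      codeᴺ-injective : ∀ {s t} (m : Name Δ s) (n : Name Δ t) →
        codeᴺ m ≡ codeᴺ n → _≡_ {A = ∃ (Name Δ)} (s , m) (t , n)
      codeᴺ-injective m n eq = let tags , args = pair-injective eq in argsᴺ-injective m n tags args

      argsᴺ-injective : ∀ {s t} (m : Name Δ s) (n : Name Δ t) →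
        tagᴺ m ≡ tagᴺ n → argsᴺ m ≡ argsᴺ n → _≡_ {A = ∃ (Name Δ)} (s , m) (t , n)
      argsᴺ-injective (pt x) (pt y) _ eq with refl ← position-injective x y eq = refl
      argsᴺ-injective (app f ms) (app g ns) _ eq
        with p , q ← pair-injective eq
        with refl ← funCode-injective p
        with refl ← codeᴺˢ-injective ms ns q = refl
      argsᴺ-injective (wit {Γ} {s} φ ms) (wit {Γ′} {t} ψ ns) _ eq
        with p , q ← pair-injective eq
        with refl ← codeᶜ-injective (s ∷ Γ) (t ∷ Γ′) p
        with q , r ← pair-injective q
        with refl ← codeF-injective φ ψ q
        with refl ← codeᴺˢ-injective ms ns r = refl

      codeᴺˢ-injective : ∀ {ss} (ms ns : All (Name Δ) ss) → codeᴺˢ ms ≡ codeᴺˢ ns → ms ≡ ns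
      codeᴺˢ-injective []       []       _  = refl
      codeᴺˢ-injective (m ∷ ms) (n ∷ ns) eq
        with p , q ← pair-injective eq
        with refl ← codeᴺ-injective m n p = cong (m ∷_) (codeᴺˢ-injective ms ns q)

    sameCode⇒≡ : ∀ {s} (m n : Name Δ s) → codeᴺ m ≡ codeᴺ n → m ≡ n
    sameCode⇒≡ m n eq with refl ← codeᴺ-injective m n eq = refl

    mutual
      name : ∀ {Γ s} → All (Name Δ) Γ → Term S Γ s → Name Δ s
      name ns (var x)    = All.lookup ns x
      name ns (app f ts) = app f (names ns ts)

      names : ∀ {Γ ss} → All (Name Δ) Γ → All (Term S Γ) ss → All (Name Δ) ss
      names ns []       = []
      names ns (t ∷ ts) = name ns t ∷ names ns ts

  -- A sentence of the Henkin language. The names stay beside the formula, since Henkin witnesses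
  -- are not terms and cannot be substituted into it.
  Sentence : Ctx S → Set
  Sentence Δ = Σ[ Γ ∈ Ctx S ] FO S Γ × All (Name Δ) Γ

  code : ∀ {Δ} → Sentence Δ → ℕ
  code (Γ , φ , ns) = pair (codeᶜ Γ) (pair (codeF φ) (codeᴺˢ ns))

  code-injective : ∀ {Δ} (a b : Sentence Δ) → code a ≡ code b → a ≡ b
  code-injective (Γ , φ , ms) (Γ′ , ψ , ns) eq
    with p , q ← pair-injective eq
    with refl ← codeᶜ-injective Γ Γ′ p
    with q , r ← pair-injective q
    with refl ← codeF-injective φ ψ q
    with refl ← codeᴺˢ-injective ms ns r = refl

Σ-≡ : ∀ {A : Set} {P : A → Set} → (∀ {a} (p q : P a) → p ≡ q) →
  {x y : Σ A P} → proj₁ x ≡ proj₁ y → x ≡ y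
Σ-≡ irr {a , p} {_ , q} refl = cong (a ,_) (irr p q)

tabulate-lookup : ∀ {A : Set} {P : A → Set} {xs : List A} (ps : All P xs) →
  All.tabulate (All.lookup ps) ≡ ps
tabulate-lookup []       = refl
tabulate-lookup (p ∷ ps) = cong (p ∷_) (tabulate-lookup ps)

-- The reduced product on Henkin names

module Limit (em : ExcludedMiddle (suc 0ℓ)) (S : Signature) (Δ : Ctx S)
             (M : ℕ → Structure S) (c : (k : ℕ) → Env S (M k) Δ) where
  open Signature S
  open Structure
  open Classical em
  open Syntax S

  witness : (N : Structure S) → ∀ {Γ s} → FO S (s ∷ Γ) → Env S N Γ → Carrier N s
  witness N {s = s} φ e with dec (Σ[ x ∈ Carrier N s ] HoldsFO S N (x ∷ e) φ)
  ... | yes (x , _) = x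
  ... | no _        = inhabited N s

  witness-holds : (N : Structure S) → ∀ {Γ s} (φ : FO S (s ∷ Γ)) (e : Env S N Γ) →
    Σ[ x ∈ Carrier N s ] HoldsFO S N (x ∷ e) φ → HoldsFO S N (witness N φ e ∷ e) φ
  witness-holds N {s = s} φ e p with dec (Σ[ x ∈ Carrier N s ] HoldsFO S N (x ∷ e) φ)
  ... | yes (_ , q) = q
  ... | no ¬p       = contradiction p ¬p

  mutual
    value : ∀ {s} → Name Δ s → (k : ℕ) → Carrier (M k) s
    value (pt x)     k = All.lookup (c k) x
    value (app f ns) k = ⟦fun⟧ (M k) f (values ns k)
    value (wit φ ns) k = witness (M k) φ (values ns k)

    values : ∀ {ss} → All (Name Δ) ss → (k : ℕ) → Env S (M k) ss
    values []       k = []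
    values (n ∷ ns) k = value n k ∷ values ns k

  values-lookup : ∀ {Γ s} (ns : All (Name Δ) Γ) (x : s ∈ Γ) k →
    value (All.lookup ns x) k ≡ All.lookup (values ns k) x
  values-lookup (n ∷ ns) (here refl) k = refl
  values-lookup (n ∷ ns) (there x)   k = values-lookup ns x k

  mutual
    value-name : ∀ {Γ s} (ns : All (Name Δ) Γ) (t : Term S Γ s) k →
      value (name ns t) k ≡ eval S (M k) (values ns k) t
    value-name ns (var x)    k = values-lookup ns x k
    value-name ns (app f ts) k = cong (⟦fun⟧ (M k) f) (values-names ns ts k)

    values-names : ∀ {Γ ss} (ns : All (Name Δ) Γ) (ts : All (Term S Γ) ss) k →
      values (names ns ts) k ≡ evals S (M k) (values ns k) ts
    values-names ns []       k = refl
    values-names ns (t ∷ ts) k = cong₂ _∷_ (value-name ns t k) (values-names ns ts k)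

  Sat : Sentence Δ → Pred ℕ 0ℓ
  Sat (_ , φ , ns) k = HoldsFO S (M k) (values ns k) φ

  -- Lists the sets `Sat a` as a sequence, the form that the filter construction takes; a number
  -- that codes no sentence receives the empty set.
  coded : ℕ → Pred ℕ 0ℓ
  coded i k = Σ[ a ∈ Sentence Δ ] code a ≡ i × Sat a k

  Most : Pred ℕ 0ℓ → Set
  Most = Large coded

  coded⇒sat : ∀ a k → coded (code a) k → Sat a k
  coded⇒sat a k (b , eq , p) with refl ← code-injective b a eq = p

  -- By injectivity of `code`, the entry of `coded` at `code a` holds exactly where `a` does, and
  -- the filter decides every entry.
  decided : ∀ a → Decided coded (Sat a)
  decided a = Sum.map (large-mono coded (coded⇒sat a))
                      (large-mono coded (λ _ ¬p p → ¬p (a , refl , p))) (large-decides coded (code a))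

  infix 4 _≈_
  record _≈_ {s} (m n : Name Δ s) : Set where
    constructor agree
    field
      agreement : Most λ k → value m k ≡ value n k
  open _≈_

  ≈-refl : ∀ {s} {n : Name Δ s} → n ≈ n
  ≈-refl = agree (large-cofinite coded 0 λ _ _ → refl)

  ≈-sym : ∀ {s} {m n : Name Δ s} → m ≈ n → n ≈ m
  ≈-sym (agree p) = agree (large-mono coded (λ _ → sym) p)

  ≈-trans : ∀ {s} {l m n : Name Δ s} → l ≈ m → m ≈ n → l ≈ n
  ≈-trans (agree p) (agree q) = agree (large-mono coded (λ _ (x , y) → trans x y) (large-∩ coded p q))

  Codes : ∀ {s} → Name Δ s → Pred ℕ 0ℓ
  Codes {s} n j = Σ[ m ∈ Name Δ s ] codeᴺ m ≡ j × m ≈ n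

  opaque
    leastCode : ∀ {s} (n : Name Δ s) → ∃[ j ] Codes n j × (∀ i → Codes n i → j ≤ i)
    leastCode n = least (Codes n) (codeᴺ n , n , refl , ≈-refl)

    rep : ∀ {s} → Name Δ s → Name Δ s
    rep n = proj₁ (proj₁ (proj₂ (leastCode n)))

    rep-≈ : ∀ {s} (n : Name Δ s) → rep n ≈ n
    rep-≈ n = proj₂ (proj₂ (proj₁ (proj₂ (leastCode n))))

    rep-least : ∀ {s} (m n : Name Δ s) → m ≈ n → codeᴺ (rep n) ≤ codeᴺ m
    rep-least m n m≈n with leastCode n
    ... | _ , (_ , refl , _) , min = min (codeᴺ m) (m , refl , m≈n)

    -- Equivalent names share their class, so neither representative has a greater code than the
    -- other; and codes determine names.
    rep-cong : ∀ {s} {m n : Name Δ s} → m ≈ n → rep m ≡ rep n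
    rep-cong {m = m} {n} m≈n = sameCode⇒≡ (rep m) (rep n) (≤-antisym
      (rep-least (rep n) m (≈-trans (rep-≈ n) (≈-sym m≈n)))
      (rep-least (rep m) n (≈-trans (rep-≈ m) m≈n)))

  Class : Sort Background → Set
  Class s = Σ[ n ∈ Name Δ s ] rep n ≡ n

  opaque
    class : ∀ {s} → Name Δ s → Class s
    class n = rep n , rep-cong (rep-≈ n)

    class-cong : ∀ {s} {m n : Name Δ s} → m ≈ n → class m ≡ class n
    class-cong m≈n = Σ-≡ uip (rep-cong m≈n)

    class-≈ : ∀ {s} {m n : Name Δ s} → class m ≡ class n → m ≈ n
    class-≈ {m = m} {n} eq = ≈-trans (≈-sym (rep-≈ m))
      (subst (_≈ n) (sym (cong proj₁ eq)) (rep-≈ n))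

    class-rep : ∀ {s} (x : Class s) → class (proj₁ x) ≡ x
    class-rep x = Σ-≡ uip (proj₂ x)

    proj₁-class : ∀ {s} (n : Name Δ s) → proj₁ (class n) ≈ n
    proj₁-class = rep-≈

  limit : Structure S
  limit = record
    { Carrier   = Class
    -- A Henkin witness without parameters names an element of any sort, even of one that has no
    -- closed terms.
    ; inhabited = λ s → class (wit {Γ = []} ⌊ var (here refl) ≐ var (here refl) ⌋ [])
    ; ⟦fun⟧     = λ f xs → class (app f (All.map proj₁ xs))
    ; ⟦rel⟧     = λ R xs → Most λ k → ⟦rel⟧ (M k) R (values (All.map proj₁ xs) k)
    }

  classes : ∀ {Γ} → All (Name Δ) Γ → Env S limit Γ
  classes = All.map class

  reps-≈ : ∀ {Γ} (ns : All (Name Δ) Γ) →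
    Most λ k → values (All.map proj₁ (classes ns)) k ≡ values ns k
  reps-≈ []       = large-cofinite coded 0 λ _ _ → refl
  reps-≈ (n ∷ ns) = large-mono coded (λ _ (p , q) → cong₂ _∷_ p q) 
    (large-∩ coded (agreement (proj₁-class n)) (reps-≈ ns))

  mutual
    eval-limit : ∀ {Γ s} (ns : All (Name Δ) Γ) (t : Term S Γ s) →
      eval S limit (classes ns) t ≡ class (name ns t)
    eval-limit ns (var x)    = lookup-map ns x
    eval-limit ns (app f ts) rewrite evals-limit ns ts =
      class-cong (agree (large-mono coded (λ k → cong (⟦fun⟧ (M k) f)) (reps-≈ (names ns ts))))

    evals-limit : ∀ {Γ ss} (ns : All (Name Δ) Γ) (ts : All (Term S Γ) ss) →
      evals S limit (classes ns) ts ≡ classes (names ns ts)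
    evals-limit ns []       = refl
    evals-limit ns (t ∷ ts) = cong₂ _∷_ (eval-limit ns t) (evals-limit ns ts)

  -- Łoś's theorem: `decided`, applied to the left subformula, supplies what maximality supplies for
  -- an ultraproduct.
  los : ∀ {Γ} (ns : All (Name Δ) Γ) (φ : QF S Γ) →
    Holds S limit (classes ns) φ ⟺ Most (λ k → Holds S (M k) (values ns k) φ)
  los ns (s ≐ t) rewrite eval-limit ns s | eval-limit ns t = mk⇔
    (λ eq → large-mono coded (λ k p → trans (sym (value-name ns s k)) (trans p (value-name ns t k)))
                       (agreement (class-≈ eq)))
    (λ st → class-cong (agree (large-mono coded
                         (λ k p → trans (value-name ns s k) (trans p (sym (value-name ns t k)))) st)))
  los ns (rel R ts) rewrite evals-limit ns ts = mk⇔
    (λ p → large-mono coded (λ k (eq , r) →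
      subst (⟦rel⟧ (M k) R) (trans eq (values-names ns ts k)) r) (large-∩ coded reps p))
    (λ p → large-mono coded (λ k (eq , r) →
      subst (⟦rel⟧ (M k) R) (sym (trans eq (values-names ns ts k))) r) (large-∩ coded reps p))
    where reps = reps-≈ (names ns ts)
  los ns (∼ φ)   = large-¬ coded (decided (_ , ⌊ φ ⌋ , ns)) ⇔-∘ ¬-cong-⇔ (los ns φ)
  los ns (φ ∧ ψ) = large-× coded ⇔-∘ (los ns φ ×-⇔ los ns ψ)
  los ns (φ ∨ ψ) = large-⊎ coded (decided (_ , ⌊ φ ⌋ , ns)) ⇔-∘ (los ns φ ⊎-⇔ los ns ψ)
  los ns (φ ⇒ ψ) = large-→ coded (decided (_ , ⌊ φ ⌋ , ns)) ⇔-∘ →-cong-⇔ (los ns φ) (los ns ψ)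

  losFO : ∀ {Γ} (ns : All (Name Δ) Γ) (φ : FO S Γ) →
    HoldsFO S limit (classes ns) φ ⟺ Most (λ k → HoldsFO S (M k) (values ns k) φ)
  losFO ns ⌊ φ ⌋    = los ns φ
  losFO ns (∼′ φ)   = large-¬ coded (decided (_ , φ , ns)) ⇔-∘ ¬-cong-⇔ (losFO ns φ)
  losFO ns (φ ∧′ ψ) = large-× coded ⇔-∘ (losFO ns φ ×-⇔ losFO ns ψ)
  losFO ns (φ ∨′ ψ) = large-⊎ coded (decided (_ , φ , ns)) ⇔-∘ (losFO ns φ ⊎-⇔ losFO ns ψ)
  losFO ns (φ ⇒′ ψ) = large-→ coded (decided (_ , φ , ns)) ⇔-∘ →-cong-⇔ (losFO ns φ) (losFO ns ψ)
  losFO ns (∀′ s φ) = mk⇔ forth back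
    where
    -- At each index `n` names a counterexample to `φ` if there is one, so truth at `n` forces truth
    -- everywhere.
    n = wit (∼′ φ) ns
    forth : (∀ x → HoldsFO S limit (x ∷ classes ns) φ) →
      Most (λ k → ∀ x → HoldsFO S (M k) (x ∷ values ns k) φ)
    forth p = large-mono coded
      (λ k q x → dne₀ λ ¬φ → witness-holds (M k) (∼′ φ) (values ns k) (x , ¬φ) q)
      (Equivalence.to (losFO (n ∷ ns) φ) (p (class n)))
    back : Most (λ k → ∀ x → HoldsFO S (M k) (x ∷ values ns k) φ) →
      ∀ x → HoldsFO S limit (x ∷ classes ns) φ
    back p x = subst (λ y → HoldsFO S limit (y ∷ classes ns) φ) (class-rep x)
      (Equivalence.from (losFO (proj₁ x ∷ ns) φ) (large-mono coded (λ k q → q _) p))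
  losFO ns (∃′ s φ) = mk⇔ forth back
    where
    n = wit φ ns
    forth : Σ[ x ∈ Class s ] HoldsFO S limit (x ∷ classes ns) φ →
      Most (λ k → Σ[ x ∈ Carrier (M k) s ] HoldsFO S (M k) (x ∷ values ns k) φ)
    forth (x , p) = large-mono coded (λ k q → _ , q)
      (Equivalence.to (losFO (proj₁ x ∷ ns) φ)
        (subst (λ y → HoldsFO S limit (y ∷ classes ns) φ) (sym (class-rep x)) p))
    back : Most (λ k → Σ[ x ∈ Carrier (M k) s ] HoldsFO S (M k) (x ∷ values ns k) φ) →
      Σ[ x ∈ Class s ] HoldsFO S limit (x ∷ classes ns) φ
    back p = class n , Equivalence.from (losFO (n ∷ ns) φ)
      (large-mono coded (λ k → witness-holds (M k) φ (values ns k)) p)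

  values-tabulate : ∀ {Γ} (f : ∀ {s} → s ∈ Γ → Name Δ s) k →
    values (All.tabulate f) k ≡ All.tabulate (λ x → value (f x) k)
  values-tabulate {[]}    f k = refl
  values-tabulate {s ∷ Γ} f k = cong (value (f (here refl)) k ∷_) (values-tabulate (λ x → f (there x)) k)

  limit-point : Env S limit Δ
  limit-point = classes (All.tabulate pt)

  limit-theory : (φ : FO S []) → (∀ k → HoldsFO S (M k) [] φ) → HoldsFO S limit [] φ
  limit-theory φ p = Equivalence.from (losFO [] φ) (large-cofinite coded 0 λ k _ → p k)

  -- Cofinite sets are large, so finitely many indices may be ignored; a ground instance is
  -- guaranteed only from its own depth on.
  limit-holds : (φ : QF S Δ) (N : ℕ) → (∀ k → N ≤ k → Holds S (M k) (c k) φ) →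
    Holds S limit limit-point φ
  limit-holds φ N p = Equivalence.from (los _ φ) (large-cofinite coded N λ k N≤k →
    subst (λ e → Holds S (M k) e φ)
      (sym (trans (values-tabulate pt k) (tabulate-lookup (c k)))) (p k N≤k))

-- Substitution, and restriction to the denoted foreground elements

module Evaluation (S : Signature) (M : Structure S) where
  open Signature S
  open Structure

  module _ {Γ Δ : Ctx S} (e : Env S M Δ) (τ : Subst S Γ Δ) where

    mutual
      eval-sub : ∀ {s} (t : Term S Γ s) → eval S M e (subᵗ S τ t) ≡ eval S M (evals S M e τ) t
      eval-sub (var x)    = lookup-evals τ x
        where
        lookup-evals : ∀ {Γ s} (τ : Subst S Γ Δ) (x : s ∈ Γ) →
          eval S M e (All.lookup τ x) ≡ All.lookup (evals S M e τ) x
        lookup-evals (t ∷ τ) (here refl) = refl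
        lookup-evals (t ∷ τ) (there x)   = lookup-evals τ x
      eval-sub (app f ts) = cong (⟦fun⟧ M f) (evals-sub ts)

      evals-sub : ∀ {ss} (ts : All (Term S Γ) ss) →
        evals S M e (subᵗˢ S τ ts) ≡ evals S M (evals S M e τ) ts
      evals-sub []       = refl
      evals-sub (t ∷ ts) = cong₂ _∷_ (eval-sub t) (evals-sub ts)

    -- Only evaluated terms differ between the two sides, so they are equal as types, and `subst id`
    -- passes from one to the other.
    holds-sub : (φ : QF S Γ) → Holds S M e (sub S τ φ) ≡ Holds S M (evals S M e τ) φ
    holds-sub (s ≐ t)    = cong₂ _≡_ (eval-sub s) (eval-sub t)
    holds-sub (rel R ts) = cong (⟦rel⟧ M R) (evals-sub ts)
    holds-sub (∼ φ)      = cong ¬_ (holds-sub φ)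
    holds-sub (φ ∧ ψ)    = cong₂ _×_ (holds-sub φ) (holds-sub ψ)
    holds-sub (φ ∨ ψ)    = cong₂ _⊎_ (holds-sub φ) (holds-sub ψ)
    holds-sub (φ ⇒ ψ)    = cong₂ (λ A B → A → B) (holds-sub φ) (holds-sub ψ)

  evals-vars : ∀ {Γ} (e : Env S M Γ) → evals S M e (vars S) ≡ e
  evals-vars e = trans (evals-tabulate var) (tabulate-lookup e)
    where
    evals-tabulate : ∀ {Γ} (f : ∀ {s} → s ∈ Γ → Term S _ s) →
      evals S M e (All.tabulate f) ≡ All.tabulate (λ x → eval S M e (f x))
    evals-tabulate {[]}    f = refl
    evals-tabulate {s ∷ Γ} f = cong (eval S M e (f (here refl)) ∷_) (evals-tabulate (λ x → f (there x)))

-- The foreground is cut down to the elements named by ground terms; values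
-- of functions outside it are replaced by a constant. Unlike in a substructure,
-- foreground values at unnamed background elements may thus be changed, but
-- no ground term mentions them.
module Restriction (em : ExcludedMiddle (suc 0ℓ)) (S : Signature) {Δ : Ctx S}
                   (M : Structure S) (c : Env S M Δ) where
  open Signature S
  open Structure
  open Classical em
  open Evaluation S M

  Denoted : ∀ {s} → Carrier M s → Set
  Denoted {s} x = Σ[ t ∈ Term S Δ s ] eval S M c t ≡ x

  -- `IsYes` forgets which term denotes the element, so being kept is proof-irrelevant and equality
  -- can be tested on the underlying elements. Background sorts stay whole for the sake of their
  -- theories.
  Kept : ∀ s → Carrier M s → Set
  Kept fg     x = IsYes (dec (Denoted x))
  Kept (bg _) x = ⊤

  kept-irrelevant : ∀ s {x} (p q : Kept s x) → p ≡ q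
  kept-irrelevant fg     p q = T-irrelevant p q
  kept-irrelevant (bg _) p q = refl

  denoted⇒kept : ∀ s {x} → Denoted x → Kept s x
  denoted⇒kept fg     d = fromWitness d
  denoted⇒kept (bg _) d = tt

  Restricted : Sort Background → Set
  Restricted s = Σ (Carrier M s) (Kept s)

  -- Keeps the cut-down foreground inhabited. The transports follow the propositional equations for
  -- the domain and codomain of the constant.
  constant-term : Term S Δ fg
  constant-term = subst (Term S Δ) constant-cod (app constant (subst (All (Term S Δ)) (sym constant-dom) []))

  default : ∀ s → Restricted s
  default fg     = eval S M c constant-term , denoted⇒kept fg (constant-term , refl)
  default (bg σ) = inhabited M (bg σ) , tt

  restrict : ∀ s → Carrier M s → Restricted s
  restrict (bg _) x = x , tt
  restrict fg     x with dec (Denoted x)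
  ... | yes d = x , denoted⇒kept fg d
  ... | no _  = default fg

  restrict-denoted : ∀ s {x} → Denoted x → proj₁ (restrict s x) ≡ x
  restrict-denoted (bg _) d = refl
  restrict-denoted fg {x} d with dec (Denoted x)
  ... | yes _ = refl
  ... | no ¬d = contradiction d ¬d

  restrict-bg : ∀ {s σ} x → s ≡ bg σ → proj₁ (restrict s x) ≡ x
  restrict-bg x refl = refl

  restriction : Structure S
  restriction = record
    { Carrier   = Restricted
    ; inhabited = default
    ; ⟦fun⟧     = λ f xs → restrict (cod f) (⟦fun⟧ M f (All.map proj₁ xs))
    ; ⟦rel⟧     = λ R xs → ⟦rel⟧ M R (All.map proj₁ xs)
    }

  forget : ∀ {Γ} → Env S restriction Γ → Env S M Γ
  forget = All.map proj₁

  ≡-restricted : ∀ {s} {x y : Restricted s} → (x ≡ y) ⟺ (proj₁ x ≡ proj₁ y)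
  ≡-restricted {s} = mk⇔ (cong proj₁) (Σ-≡ (kept-irrelevant s))

  module _ {Γ} (e : Env S restriction Γ) (τ : Subst S Γ Δ) (e≡τ : forget e ≡ evals S M c τ) where

    mutual
      -- Every intermediate value is denoted by a ground term, so the default in `restrict` is never
      -- reached.
      eval-denoted : ∀ {s} (t : Term S Γ s) →
        proj₁ (eval S restriction e t) ≡ eval S M (evals S M c τ) t
      eval-denoted (var x) = trans (sym (lookup-map e x)) (cong (λ e → All.lookup e x) e≡τ)
      eval-denoted (app f ts) = trans
        (restrict-denoted (cod f) (app f (subᵗˢ S τ ts) ,
          cong (⟦fun⟧ M f) (trans (evals-sub c τ ts) (sym (evals-denoted ts)))))
        (cong (⟦fun⟧ M f) (evals-denoted ts))

      evals-denoted : ∀ {ss} (ts : All (Term S Γ) ss) →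
        forget (evals S restriction e ts) ≡ evals S M (evals S M c τ) ts
      evals-denoted []       = refl
      evals-denoted (t ∷ ts) = cong₂ _∷_ (eval-denoted t) (evals-denoted ts)

    holds-denoted : (φ : QF S Γ) → Holds S restriction e φ ⟺ Holds S M (evals S M c τ) φ
    holds-denoted (s ≐ t) rewrite sym (eval-denoted s) | sym (eval-denoted t) = ≡-restricted
    holds-denoted (rel R ts) = ≡⇒ (cong (⟦rel⟧ M R) (evals-denoted ts))
    holds-denoted (∼ φ)      = ¬-cong-⇔ (holds-denoted φ)
    holds-denoted (φ ∧ ψ)    = holds-denoted φ ×-⇔ holds-denoted ψ
    holds-denoted (φ ∨ ψ)    = holds-denoted φ ⊎-⇔ holds-denoted ψ
    holds-denoted (φ ⇒ ψ)    = →-cong-⇔ (holds-denoted φ) (holds-denoted ψ)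

  module _ {σ : Background} where

    mutual
      eval-only : ∀ {Γ s} (e : Env S restriction Γ) (t : Term S Γ s) → Onlyᵗ S σ t →
        proj₁ (eval S restriction e t) ≡ eval S M (forget e) t
      eval-only e (var x)    _       = sym (lookup-map e x)
      eval-only e (app f ts) (p , o) =
        trans (restrict-bg _ p) (cong (⟦fun⟧ M f) (evals-only e ts o))

      evals-only : ∀ {Γ ss} (e : Env S restriction Γ) (ts : All (Term S Γ) ss) → Onlyᵗˢ S σ ts →
        forget (evals S restriction e ts) ≡ evals S M (forget e) ts
      evals-only e []       _       = refl
      evals-only e (t ∷ ts) (o , p) = cong₂ _∷_ (eval-only e t o) (evals-only e ts p)

    holds-only : ∀ {Γ} (e : Env S restriction Γ) (φ : QF S Γ) → OnlyQF S σ φ →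
      Holds S restriction e φ ⟺ Holds S M (forget e) φ
    holds-only e (s ≐ t)    (o , p) rewrite sym (eval-only e s o) | sym (eval-only e t p) = ≡-restricted
    holds-only e (rel R ts) (o , _) = ≡⇒ (cong (⟦rel⟧ M R) (evals-only e ts o))
    holds-only e (∼ φ)      o       = ¬-cong-⇔ (holds-only e φ o)
    holds-only e (φ ∧ ψ)    (o , p) = holds-only e φ o ×-⇔ holds-only e ψ p
    holds-only e (φ ∨ ψ)    (o , p) = holds-only e φ o ⊎-⇔ holds-only e ψ p
    holds-only e (φ ⇒ ψ)    (o , p) = →-cong-⇔ (holds-only e φ o) (holds-only e ψ p)

    -- Functions into a background sort keep their values, and the quantifiers range over the whole
    -- of that sort, so the theories survive the cut.
    holdsFO-only : ∀ {Γ} (e : Env S restriction Γ) (φ : FO S Γ) → Only S σ φ →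
      HoldsFO S restriction e φ ⟺ HoldsFO S M (forget e) φ
    holdsFO-only e ⌊ φ ⌋    o       = holds-only e φ o
    holdsFO-only e (∼′ φ)   o       = ¬-cong-⇔ (holdsFO-only e φ o)
    holdsFO-only e (φ ∧′ ψ) (o , p) = holdsFO-only e φ o ×-⇔ holdsFO-only e ψ p
    holdsFO-only e (φ ∨′ ψ) (o , p) = holdsFO-only e φ o ⊎-⇔ holdsFO-only e ψ p
    holdsFO-only e (φ ⇒′ ψ) (o , p) = →-cong-⇔ (holdsFO-only e φ o) (holdsFO-only e ψ p)
    holdsFO-only e (∀′ s φ) (refl , o) = mk⇔
      (λ p x → Equivalence.to (holdsFO-only ((x , tt) ∷ e) φ o) (p (x , tt)))
      (λ p x → Equivalence.from (holdsFO-only (x ∷ e) φ o) (p (proj₁ x)))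
    holdsFO-only e (∃′ s φ) (refl , o) = mk⇔
      (λ (x , p) → proj₁ x , Equivalence.to (holdsFO-only (x ∷ e) φ o) p)
      (λ (x , p) → (x , tt) , Equivalence.from (holdsFO-only ((x , tt) ∷ e) φ o) p)

  -- A kept foreground element has a denoting term that can be recovered; this is how a universal
  -- sentence in the restriction comes down to ground instances.
  denoting : ∀ {Γ} → Foreground S Γ → (e : Env S restriction Γ) →
    Σ[ τ ∈ Subst S Γ Δ ] forget e ≡ evals S M c τ
  denoting []         []            = [] , refl
  denoting (refl ∷ p) ((x , k) ∷ e) =
    let t , eq  = toWitness k
        τ , eqs = denoting p e
    in t ∷ τ , cong₂ _∷_ (sym eq) eqs

  point : Env S restriction Δ
  point = All.tabulate λ {s} x → All.lookup c x , denoted⇒kept s (var x , refl)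

  forget-point : forget point ≡ c
  forget-point = trans (forget-tabulate _) (tabulate-lookup c)
    where
    forget-tabulate : ∀ {Γ} (f : ∀ {s} → s ∈ Γ → Restricted s) →
      forget (All.tabulate f) ≡ All.tabulate (λ x → proj₁ (f x))
    forget-tabulate {[]}    f = refl
    forget-tabulate {s ∷ Γ} f = cong (proj₁ (f (here refl)) ∷_) (forget-tabulate (λ x → f (there x)))

-- Compactness and Herbrand's theorem

module Herbrand (em : ExcludedMiddle (suc 0ℓ)) (S : Signature) (𝒯 : Theories S) where
  open Classical em
  open Theories 𝒯
  open Universal
  open Evaluation S

  bounded : ∀ {k Γ Δ} (ts : Subst S Γ Δ) → depths S ts ≤ k →
    Σ[ us ∈ All (TermsUpTo S 𝒯 k Δ) Γ ] All.map proj₁ us ≡ ts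
  bounded []       _ = [] , refl
  bounded (t ∷ ts) p =
    let us , eq = bounded ts (≤-trans (m≤n⊔m (ℕ.suc (depth S t)) (depths S ts)) p)
    -- `depths` counts each term one deeper than `depth` does, hence the step down by one.
    in (t , ≤-trans (n≤1+n _) (≤-trans (m≤m⊔n _ (depths S ts)) p)) ∷ us , cong (t ∷_) eq

  instance-∈ : ∀ {k Δ} (Ψ : Pred (Universal S) 0ℓ) {V} → Ψ V → (τ : Subst S (ctx V) Δ) →
    depths S τ ≤ k → (_[T_] S 𝒯 Ψ k) (sub S τ (matrix V))
  instance-∈ Ψ {V} V∈Ψ τ p with us , refl ← bounded τ p = V , V∈Ψ , us , refl

  -- If no depth sufficed, every depth `k` would have a model of its instances. The limit of these
  -- models satisfies all ground instances, its restriction satisfies `Ψ` as universal sentences,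
  -- and `U` still fails at the Skolem constants.
  herbrand : ∀ Ψ U → (_⊨_ S 𝒯 Ψ U) → ∃[ k ] Valid S 𝒯 Ψ U k
  herbrand Ψ U Ψ⊨U = dne λ ¬valid → absurd λ k → dne λ ¬sat → ¬valid (k , ¬sat)
    where
    absurd : ¬ (∀ k → Satisfiable S 𝒯 (refutation S 𝒯 Ψ U k))
    absurd sat = ¬U (subst (λ e → Holds S limit e (matrix U)) (evals-vars limit limit-point)
      (Equivalence.to (holds-denoted point (vars S) point≡vars (matrix U)) U-true))
      where
      open module Sat k = Pointed (proj₁ (sat k)) using (structure) renaming (point to skolem)
      open Limit em S (ctx U) structure skolem
      open Restriction em S limit limit-point

      limit-instance : ∀ {V} → Ψ V → (τ : Subst S (ctx V) (ctx U)) →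
        Holds S limit (evals S limit limit-point τ) (matrix V)
      limit-instance {V} V∈Ψ τ = subst id (holds-sub limit limit-point τ (matrix V))
        -- From this depth on, the instance is among the formulas that the chosen models satisfy.
        (limit-holds (sub S τ (matrix V)) (depths S τ)
          λ k p → proj₂ (proj₂ (sat k)) (inj₁ (instance-∈ Ψ V∈Ψ τ p)))

      ¬U : ¬ Holds S limit limit-point (matrix U)
      ¬U = limit-holds (∼ matrix U) 0 λ k _ → proj₂ (proj₂ (sat k)) (inj₂ refl)

      point≡vars : forget point ≡ evals S limit limit-point (vars S)
      point≡vars = trans forget-point (sym (evals-vars limit limit-point))

      model : Model S 𝒯 restriction
      model {φ = φ} a = Equivalence.from (holdsFO-only [] φ (only a))
        (limit-theory φ λ k → proj₁ (proj₂ (sat k)) a)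

      U-true : Holds S restriction point (matrix U)
      U-true = Ψ⊨U restriction model (λ {V} V∈Ψ e →
        let τ , eq = denoting (ctx-fg V) e
        in Equivalence.from (holds-denoted e τ eq (matrix V)) (limit-instance V∈Ψ τ)) point

-- Monotonicity, least fixpoints and fixpoint induction

Interpretation : ∀ {S} → Structure S → Set₁
Interpretation {S} M = ∀ R → Pred (Env S M (Signature.arity S R)) 0ℓ

module Reinterpretation (S : Signature) (M : Structure S) where
  open Signature S
  open Structure

  infix 6 _with-rel_
  _with-rel_ : (N : Structure S) → Interpretation N → Structure S
  N with-rel r = record N { ⟦rel⟧ = r }

  mutual
    eval-with-rel : ∀ r {Γ s} (e : Env S M Γ) (t : Term S Γ s) →
      eval S (M with-rel r) e t ≡ eval S M e t
    eval-with-rel r e (var x)    = refl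
    eval-with-rel r e (app f ts) = cong (⟦fun⟧ M f) (evals-with-rel r e ts)

    evals-with-rel : ∀ r {Γ ss} (e : Env S M Γ) (ts : All (Term S Γ) ss) →
      evals S (M with-rel r) e ts ≡ evals S M e ts
    evals-with-rel r e []       = refl
    evals-with-rel r e (t ∷ ts) = cong₂ _∷_ (eval-with-rel r e t) (evals-with-rel r e ts)

  -- The order for which positive formulas are monotone: only recursive relations may grow.
  record _⊑_ (r r′ : Interpretation M) : Set where
    field
      include : ∀ R {xs} → r R xs → r′ R xs
      reflect : ∀ R {xs} → ¬ T (isRec R) → r′ R xs → r R xs
  open _⊑_

  module _ {r r′ : Interpretation M} (r⊑r′ : r ⊑ r′) where

    eval≡ : ∀ {Γ s} (e : Env S M Γ) (t : Term S Γ s) →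
      eval S (M with-rel r) e t ≡ eval S (M with-rel r′) e t
    eval≡ e t = trans (eval-with-rel r e t) (sym (eval-with-rel r′ e t))

    evals≡ : ∀ {Γ ss} (e : Env S M Γ) (ts : All (Term S Γ) ss) →
      evals S (M with-rel r) e ts ≡ evals S (M with-rel r′) e ts
    evals≡ e ts = trans (evals-with-rel r e ts) (sym (evals-with-rel r′ e ts))

    mutual
      -- Polarity flips under negation and to the left of an implication, so this and `holds-anti`
      -- are proved together. A negative atom is non-recursive, and there `reflect` applies.
      holds-mono : ∀ {Γ} (e : Env S M Γ) (φ : QF S Γ) → OccursRec S Sign.+ φ →
        Holds S (M with-rel r) e φ → Holds S (M with-rel r′) e φ
      holds-mono e (s ≐ t)    o       p        = trans (sym (eval≡ e s)) (trans p (eval≡ e t))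
      holds-mono e (rel R ts) o       p        = include r⊑r′ R (subst (r R) (evals≡ e ts) p)
      holds-mono e (∼ φ)      o       ¬p p     = ¬p (holds-anti e φ o p)
      holds-mono e (φ ∧ ψ)    (o , q) (x , y)  = holds-mono e φ o x , holds-mono e ψ q y
      holds-mono e (φ ∨ ψ)    (o , q) (inj₁ x) = inj₁ (holds-mono e φ o x)
      holds-mono e (φ ∨ ψ)    (o , q) (inj₂ y) = inj₂ (holds-mono e ψ q y)
      holds-mono e (φ ⇒ ψ)    (o , q) f x      = holds-mono e ψ q (f (holds-anti e φ o x))

      holds-anti : ∀ {Γ} (e : Env S M Γ) (φ : QF S Γ) → OccursRec S Sign.- φ →
        Holds S (M with-rel r′) e φ → Holds S (M with-rel r) e φ
      holds-anti e (s ≐ t)    o       p        = trans (eval≡ e s) (trans p (sym (eval≡ e t)))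
      holds-anti e (rel R ts) o       p        = reflect r⊑r′ R o (subst (r′ R) (sym (evals≡ e ts)) p)
      holds-anti e (∼ φ)      o       ¬p p     = ¬p (holds-mono e φ o p)
      holds-anti e (φ ∧ ψ)    (o , q) (x , y)  = holds-anti e φ o x , holds-anti e ψ q y
      holds-anti e (φ ∨ ψ)    (o , q) (inj₁ x) = inj₁ (holds-anti e φ o x)
      holds-anti e (φ ∨ ψ)    (o , q) (inj₂ y) = inj₂ (holds-anti e ψ q y)
      holds-anti e (φ ⇒ ψ)    (o , q) f x      = holds-anti e ψ q (f (holds-mono e φ o x))

  module Strengthened (R : Rel) (ψ : QF S (arity R)) where

    -- What `strengthen` does to formulas, done to the interpretation instead. The conjunct `ψ` is
    -- read in `M`, since `strengthen` does not descend into the copies of `ψ` that it inserts.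
    strengthened : Interpretation M
    strengthened R′ xs with R ≟ᴿ R′
    ... | yes refl = Holds S M xs ψ × ⟦rel⟧ M R xs
    ... | no _     = ⟦rel⟧ M R′ xs

    holds-strengthen : ∀ {Γ} (e : Env S M Γ) (φ : QF S Γ) →
      Holds S M e (strengthen S R ψ φ) ⟺ Holds S (M with-rel strengthened) e φ
    holds-strengthen e (s ≐ t)
      rewrite eval-with-rel strengthened e s | eval-with-rel strengthened e t = ≡⇒ refl
    holds-strengthen e (rel R′ ts) rewrite evals-with-rel strengthened e ts with R ≟ᴿ R′
    ... | yes refl = ≡⇒ (cong (_× _) (Evaluation.holds-sub S M e ts ψ))
    ... | no _     = ≡⇒ refl
    holds-strengthen e (∼ φ)   = ¬-cong-⇔ (holds-strengthen e φ)
    holds-strengthen e (φ ∧ χ) = holds-strengthen e φ ×-⇔ holds-strengthen e χ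
    holds-strengthen e (φ ∨ χ) = holds-strengthen e φ ⊎-⇔ holds-strengthen e χ
    holds-strengthen e (φ ⇒ χ) = →-cong-⇔ (holds-strengthen e φ) (holds-strengthen e χ)

    strengthened-⊑ : T (isRec R) → strengthened ⊑ ⟦rel⟧ M
    strengthened-⊑ rec = record { include = include′ ; reflect = reflect′ }
      where
      include′ : ∀ R′ {xs} → strengthened R′ xs → ⟦rel⟧ M R′ xs
      include′ R′ p with R ≟ᴿ R′
      ... | yes refl = proj₂ p
      ... | no _     = p
      reflect′ : ∀ R′ {xs} → ¬ T (isRec R′) → ⟦rel⟧ M R′ xs → strengthened R′ xs
      reflect′ R′ ¬rec p with R ≟ᴿ R′
      ... | yes refl = contradiction rec ¬rec
      ... | no _     = p

    strengthened-intro : ∀ R′ {xs} → ⟦rel⟧ M R′ xs →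
      ((eq : R ≡ R′) → Holds S M (subst (λ Q → Env S M (arity Q)) (sym eq) xs) ψ) → strengthened R′ xs
    strengthened-intro R′ p h with R ≟ᴿ R′
    ... | yes refl = h refl , p
    ... | no _     = p

    strengthened-elim : ∀ {xs} → strengthened R xs → Holds S M xs ψ
    strengthened-elim p with R ≟ᴿ R
    ... | yes refl = proj₁ p
    ... | no R≢R   = contradiction refl R≢R

module FixpointInduction (em : ExcludedMiddle (suc 0ℓ)) (S : Signature) (𝒯 : Theories S)
                         (D : Definitions S) (M : Structure S) where
  open Signature S
  open Structure
  open Definitions D
  open Reinterpretation S M
  open _⊑_

  merge : Interpretation M → Interpretation M
  merge I R xs = if isRec R then I R xs else ⟦rel⟧ M R xs

  merge-rec : ∀ I {R} {xs} → T (isRec R) → merge I R xs ≡ I R xs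
  merge-rec I {R} rec with true ← isRec R = refl

  Prefixed : Interpretation M → Set
  Prefixed I = ∀ R {e} → Holds S (M with-rel merge I) e (body R) → I (proj₁ R) e

  merge-mono : ∀ {I J : Interpretation M} →
    (∀ R → T (isRec R) → ∀ {xs} → I R xs → J R xs) → merge I ⊑ merge J
  merge-mono {I} {J} I⊆J = record { include = include′ ; reflect = reflect′ }
    where
    include′ : ∀ R {xs} → merge I R xs → merge J R xs
    include′ R p with isRec R in eq
    ... | true  = I⊆J R (subst T (sym eq) tt) p
    ... | false = p
    reflect′ : ∀ R {xs} → ¬ T (isRec R) → merge J R xs → merge I R xs
    reflect′ R ¬rec p with isRec R
    ... | true  = contradiction tt ¬rec
    ... | false = p

  -- Excluded middle makes the intersection of all prefixed points a small predicate.
  least-prefixed : Interpretation M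
  least-prefixed R xs = IsYes (em {∀ I → Prefixed I → I R xs})

  least-prefixed-⊆ : ∀ {I} → Prefixed I → ∀ {R xs} → least-prefixed R xs → I R xs
  least-prefixed-⊆ {I} pre p = toWitness p I pre

  least-prefixed-prefixed : Prefixed least-prefixed
  least-prefixed-prefixed R {e} p = fromWitness λ I pre → pre R
    (holds-mono (merge-mono (λ _ _ → least-prefixed-⊆ pre)) e (body R) (positive R) p)

  -- The Knaster-Tarski argument: evaluating the bodies once at the least prefixed point gives
  -- another prefixed point, which therefore contains it.
  least-prefixed-unfold : ∀ R {e} → least-prefixed (proj₁ R) e →
    Holds S (M with-rel merge least-prefixed) e (body R)
  least-prefixed-unfold (R , r) {e} p =
    let r′ , q = least-prefixed-⊆ unfolded-prefixed p
    in subst (λ r → Holds S (M with-rel merge least-prefixed) e (body (R , r))) (T-irrelevant r′ r) q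
    where
    unfolded : Interpretation M
    unfolded R xs = Σ[ r ∈ T (isRec R) ] Holds S (M with-rel merge least-prefixed) xs (body (R , r))
    unfolded-prefixed : Prefixed unfolded
    unfolded-prefixed R p = proj₂ R , holds-mono
      (merge-mono λ { _ _ (r , q) → least-prefixed-prefixed (_ , r) q }) _ (body R) (positive R) p

  least-prefixed-fixpoint : ∀ R → True S (reinterpret S 𝒯 D M least-prefixed) (fixpoint S 𝒯 D R)
  least-prefixed-fixpoint (R , r) e =
    (λ p → least-prefixed-unfold (R , r) (subst id atom≡ p)) ,
    (λ p → subst id (sym atom≡) (least-prefixed-prefixed (R , r) p))
    where
    atom≡ : merge least-prefixed R (evals S (M with-rel merge least-prefixed) e (vars S)) ≡
            least-prefixed R e
    atom≡ = trans (merge-rec least-prefixed r)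
      (cong (least-prefixed R) (Evaluation.evals-vars S (M with-rel merge least-prefixed) e))

  -- `LFP` speaks of minimality among fixpoints; as the least prefixed point is a fixpoint,
  -- minimality extends to all prefixed points.
  lfp-least : LFP S 𝒯 D M → ∀ {I} → Prefixed I → ∀ {R} → T (isRec R) → ∀ {xs} → ⟦rel⟧ M R xs → I R xs
  lfp-least (_ , least) pre {R} r p =
    least-prefixed-⊆ pre (least least-prefixed least-prefixed-fixpoint R r p)

  -- Cutting `R` down to `R ∧ ψ` leaves a prefixed point: monotonicity and the fixpoint equations
  -- give the relations themselves, and the PFP gives `ψ` on `R`. The least fixpoint thus lies
  -- inside it.
  lfp-induction : LFP S 𝒯 D M → ∀ L → True S M (PFP S 𝒯 D L) → True S M (lemma S L)
  lfp-induction lfp ((R , r) ⊃ ψ) pfp e p = strengthened-elim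
    (lfp-least lfp prefixed r (subst (⟦rel⟧ M R) (Evaluation.evals-vars S M e) p))
    where
    open Strengthened R ψ

    -- Only the recursive `R` was cut down, so resetting the non-recursive relations to those of `M`
    -- changes nothing.
    merge-⊑ : merge strengthened ⊑ strengthened
    merge-⊑ = record { include = include′ ; reflect = reflect′ }
      where
      include′ : ∀ R′ {xs} → merge strengthened R′ xs → strengthened R′ xs
      include′ R′ p with isRec R′ in eq
      ... | true  = p
      ... | false = reflect (strengthened-⊑ r) R′ (subst T eq) p
      reflect′ : ∀ R′ {xs} → ¬ T (isRec R′) → strengthened R′ xs → merge strengthened R′ xs
      reflect′ R′ ¬rec p with isRec R′ in eq
      ... | true  = contradiction tt ¬rec
      ... | false = include (strengthened-⊑ r) R′ p

    prefixed : Prefixed strengthened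
    prefixed Q {e} p = strengthened-intro (proj₁ Q) rel-holds consequent-holds
      where
      p′ : Holds S (M with-rel strengthened) e (body Q)
      p′ = holds-mono merge-⊑ e (body Q) (positive Q) p
      rel-holds : ⟦rel⟧ M (proj₁ Q) e
      rel-holds = subst (⟦rel⟧ M (proj₁ Q)) (Evaluation.evals-vars S M e)
        (proj₂ (proj₁ lfp Q e) (holds-mono (strengthened-⊑ r) e (body Q) (positive Q) p′))
      consequent-holds : (eq : R ≡ proj₁ Q) →
        Holds S M (subst (λ Q → Env S M (arity Q)) (sym eq) e) ψ
      consequent-holds refl with refl ← T-irrelevant r (proj₂ Q) =
        pfp e (Equivalence.from (holds-strengthen e (body Q)) p′)

-- Counting, prefixes of lists, and finiteness of the bounded language

module _ {a p} {A : Set a} {P : Pred A p} (P? : ∀ x → Dec (P x)) where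

  count : List A → ℕ
  count xs = length (filter P? xs)

module _ {a p q} {A : Set a} {P : Pred A p} {Q : Pred A q}
         (P? : ∀ x → Dec (P x)) (Q? : ∀ x → Dec (Q x)) (P⊆Q : ∀ x → P x → Q x) where

  count-mono : ∀ xs → count P? xs ≤ count Q? xs
  count-mono []       = z≤n
  count-mono (x ∷ xs) with P? x | Q? x
  ... | yes _ | yes _ = s≤s (count-mono xs)
  ... | yes p | no ¬q = contradiction (P⊆Q x p) ¬q
  ... | no _  | yes _ = m≤n⇒m≤1+n (count-mono xs)
  ... | no _  | no _  = count-mono xs

  count-strict : ∀ {x xs} → x ∈ xs → Q x → ¬ P x → count P? xs < count Q? xs
  count-strict {x} {_ ∷ xs} (here refl) q ¬p with P? x | Q? x
  ... | yes p | _     = contradiction p ¬p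
  ... | no _  | yes _ = s≤s (count-mono xs)
  ... | no _  | no ¬q = contradiction q ¬q
  count-strict {xs = y ∷ xs} (there x∈xs) q ¬p with P? y | Q? y
  ... | yes _ | yes _ = s≤s (count-strict x∈xs q ¬p)
  ... | yes p | no ¬q = contradiction (P⊆Q y p) ¬q
  ... | no _  | yes _ = m≤n⇒m≤1+n (count-strict x∈xs q ¬p)
  ... | no _  | no _  = count-strict x∈xs q ¬p

-- `P` relates an entry to the prefix before it. In the recursive call it absorbs the head `y`, so
-- that prefixes of the tail are seen as prefixes of the whole list.
take-lookup-∷ʳ : ∀ {a p} {A : Set a} (P : List A → A → Set p) xs {x} →
  (∀ i → P (take (toℕ i) xs) (lookup xs i)) → P xs x →
  ∀ i → P (take (toℕ i) (xs ∷ʳ x)) (lookup (xs ∷ʳ x) i)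
take-lookup-∷ʳ P []       p q Fin.zero    = q
take-lookup-∷ʳ P (y ∷ ys) p q Fin.zero    = p Fin.zero
take-lookup-∷ʳ P (y ∷ ys) p q (Fin.suc i) =
  take-lookup-∷ʳ (λ zs → P (y ∷ zs)) ys (λ j → p (Fin.suc j)) q i

module Language (S : Signature) (G : Grammar S) where
  open Grammar G
  open Injection print using (injective) renaming (to to printed)

  mutual
    words : ℕ → Fin nonterminals → List (List Token)
    words zero      A = []
    words (ℕ.suc h) A = concatMap (expansions h) (rules A)

    expansions : ℕ → List (Token ⊎ Fin nonterminals) → List (List Token)
    expansions h []             = [] ∷ []
    expansions h (inj₁ a ∷ rhs) = map (a ∷_) (expansions h rhs)
    expansions h (inj₂ A ∷ rhs) = cartesianProductWith _++_ (words h A) (expansions h rhs)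

  mutual
    yield-∈ : ∀ {h A} (t : ParseTree S G A) → height S G t ≤ h → yield S G t ∈ words h A
    yield-∈ {A = A} (node {rhs} rhs∈ ts) (s≤s p) =
      ∈-concatMap⁺ (expansions _) (Any.map (λ { refl → yields-∈ ts p }) rhs∈)

    yields-∈ : ∀ {h rhs} (ts : Forest S G rhs) → heights S G ts ≤ h → yields S G ts ∈ expansions h rhs
    yields-∈ []          p = here refl
    yields-∈ (leaf a ts) p = ∈-map⁺ (a ∷_) (yields-∈ ts p)
    yields-∈ (t ∷ ts)    p = ∈-cartesianProductWith⁺ _++_
      (yield-∈ t (≤-trans (m≤m⊔n _ _) p)) (yields-∈ ts (≤-trans (m≤n⊔m (height S G t) _) p))

  module _ (em : ExcludedMiddle (suc 0ℓ)) where
    open Classical em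

    -- A word is the print of at most one lemma, as `print` is injective, and excluded middle tells
    -- whether there is one.
    parsed : ∀ ws → Σ[ Ls ∈ List (Lemma S) ] (∀ L → printed L ∈ ws → L ∈ Ls)
    parsed []       = [] , λ _ ()
    parsed (w ∷ ws) with parsed ws | dec (Σ[ L ∈ Lemma S ] printed L ≡ w)
    ... | Ls , p | yes (L , refl) = L ∷ Ls , λ
      { L′ (here eq)  → here (injective eq)
      ; L′ (there L∈) → there (p L′ L∈) }
    ... | Ls , p | no ¬L = Ls , λ
      { L′ (here eq)  → contradiction (L′ , eq) ¬L
      ; L′ (there L∈) → p L′ L∈ }

    langUpTo-finite : ∀ h → Σ[ Ls ∈ List (Lemma S) ] (∀ L → LangUpTo S G h L → L ∈ Ls)
    langUpTo-finite h =
      let Ls , p = parsed (words h start)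
      in Ls , λ { L (t , eq , t≤h) → p L (subst (_∈ _) eq (yield-∈ t t≤h)) }

  lang⇒langUpTo : ∀ {Ls} → All (Lang S G) Ls → ∃[ h ] All (LangUpTo S G h) Ls
  lang⇒langUpTo []              = 0 , []
  lang⇒langUpTo ((t , eq) ∷ ps) =
    let h , qs = lang⇒langUpTo ps
    in height S G t ⊔ h ,
       (t , eq , m≤m⊔n _ h) ∷ All.map (λ (u , eq , p) → u , eq , ≤-trans p (m≤n⊔m (height S G t) h)) qs

-- Validity at a bounded depth

module Validity (em : ExcludedMiddle (suc 0ℓ)) (S : Signature) (𝒯 : Theories S) where
  open Classical em
  open Universal
  open Evaluation S

  valid-mono : ∀ Ψ U {k k′} → k ≤ k′ → Valid S 𝒯 Ψ U k → Valid S 𝒯 Ψ U k′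
  valid-mono Ψ U {k} {k′} k≤k′ valid (P , model , sat) = valid (P , model , sat′)
    where
    sat′ : ∀ {φ} → refutation S 𝒯 Ψ U k φ → Holds S (Pointed.structure P) (Pointed.point P) φ
    sat′ (inj₁ (V , v , ts , refl)) =
      sat (inj₁ (V , v , All.map (λ (t , p) → t , ≤-trans p k≤k′) ts ,
        cong (λ τ → sub S τ (matrix V)) (sym (map-∘ ts))))
    sat′ (inj₂ eq) = sat (inj₂ eq)

  valid-sound : ∀ Ψ U {k} → Valid S 𝒯 Ψ U k → _⊨_ S 𝒯 Ψ U
  valid-sound Ψ U {k} valid M model Ψ-true e = dne₀ λ ¬U → valid ((M at e) , model , sat ¬U)
    where
    sat : ¬ Holds S M e (matrix U) → ∀ {φ} → refutation S 𝒯 Ψ U k φ → Holds S M e φ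
    sat ¬U (inj₁ (V , v , ts , refl)) = subst id (sym (holds-sub M e _ (matrix V))) (Ψ-true v _)
    sat ¬U (inj₂ refl)                = ¬U

-- Runs of FOSSIL from a sufficient depth and height

module Fossil
  (em : ExcludedMiddle (suc 0ℓ)) (S : Signature) (𝒯 : Theories S)
  (A : List (Universal S)) (D : Definitions S) (G : Grammar S) (α : Universal S) (size : ℕ)
  (target : List (Lemma S)) (k h : ℕ)
  (target-lang : All (LangUpTo S G h) target)
  (target-α : Valid S 𝒯 (context S 𝒯 D A target) α k)
  (target-PFP : ∀ {L} → L ∈ target → Valid S 𝒯 (context S 𝒯 D A []) (PFP S 𝒯 D L) k)
  where
  open Classical em
  open Validity em S 𝒯
  open Evaluation S
  open Signature S using (arity)
  open Structure
  open Universal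
  open Lemma
  open Pointed

  Γ : List (Lemma S) → Pred (Universal S) 0ℓ
  Γ = context S 𝒯 D A

  Examples : Set₁
  Examples = List (Stored S 𝒯 D A G α size)

  Cand : Pointed S 𝒯 (ctx α) → Examples → Examples → Lemma S → Set₁
  Cand = Candidate S 𝒯 D A G α size k h

  context-mono : ∀ {Ls V} → Γ [] V → Γ Ls V
  context-mono (inj₁ a)        = inj₁ a
  context-mono (inj₂ (inj₁ f)) = inj₂ (inj₁ f)

  module _ (P : Pointed S 𝒯 (ctx α)) where

    Tuple : Ctx S → Set
    Tuple = All (Named S 𝒯 D A G α size k P)

    denote : ∀ {Δ} → All (TermsUpTo S 𝒯 k (ctx α)) Δ → Tuple Δ
    denote = All.map λ t → eval S (structure P) (point P) (proj₁ t) , t , refl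

    denote-evals : ∀ {Δ} (ts : All (TermsUpTo S 𝒯 k (ctx α)) Δ) →
      evals S (structure P) (point P) (All.map proj₁ ts) ≡ All.map proj₁ (denote ts)
    denote-evals []       = refl
    denote-evals (t ∷ ts) = cong (_ ∷_) (denote-evals ts)

    terms : ∀ {Δ} → Tuple Δ → All (TermsUpTo S 𝒯 k (ctx α)) Δ
    terms = All.map λ x → proj₁ (proj₂ x)

    terms-evals : ∀ {Δ} (xs : Tuple Δ) →
      evals S (structure P) (point P) (All.map proj₁ (terms xs)) ≡ All.map proj₁ xs
    terms-evals []                    = refl
    terms-evals ((x , t , refl) ∷ xs) = cong (_ ∷_) (terms-evals xs)

  -- A candidate fails in the Type-1 model at elements named by terms of `T_k`. For an accepted
  -- lemma, the instance at those very terms is among the formulas that the model satisfies.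
  candidate-fresh : ∀ {Ls P T2 T3 L} → Type1 S 𝒯 D A G α size k Ls P → Cand P T2 T3 L → L ∉ Ls
  candidate-fresh {Ls} {P} {L = L} (_ , sat) cand L∈Ls =
    let xs , ¬L = Candidate.falseInM₁ cand
        lemma-holds = sat (inj₁ (lemma S L , inj₂ (inj₂ (∈-map⁺ (lemma S) L∈Ls)) , terms P xs , refl))
    in ¬L (subst (λ e → Holds S (structure P) e (matrix (lemma S L))) (terms-evals P xs)
             (subst id (holds-sub (structure P) (point P) _ (matrix (lemma S L))) lemma-holds))

  -- The part of being a candidate that depends on the stored counterexamples alone; the invariant
  -- and the termination measure are both stated with it.
  Consistent : Examples → Examples → Lemma S → Set₁
  Consistent T2 T3 L =
    (∀ {M c} → (antecedent L , (M at c)) ∈ T2 → Holds S M c (matrix (lemma S L))) ×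
    (∀ {M c} → (antecedent L , (M at c)) ∈ T3 → Holds S M c (matrix (PFP S 𝒯 D L)))

  -- Were every target lemma true at all tuples named by T_k, the Type-1 model would refute target-α.
  candidate-exists : ∀ {Ls P T2 T3} → Type1 S 𝒯 D A G α size k Ls P →
    (∀ {L} → L ∈ target → Consistent T2 T3 L) → ∃[ L ] Cand P T2 T3 L
  candidate-exists {Ls} {P} {T2} {T3} (model , sat) consistent =
    dne λ none → target-α (P , model , sat′ none)
    where
    sat′ : ¬ (∃[ L ] Cand P T2 T3 L) → ∀ {φ} →
      refutation S 𝒯 (Γ target) α k φ → Holds S (structure P) (point P) φ
    sat′ none (inj₂ eq) = sat (inj₂ eq)
    sat′ none (inj₁ (V , inj₁ a , ts , eq)) = sat (inj₁ (V , inj₁ a , ts , eq))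
    sat′ none (inj₁ (V , inj₂ (inj₁ f) , ts , eq)) = sat (inj₁ (V , inj₂ (inj₁ f) , ts , eq))
    sat′ none (inj₁ (V , inj₂ (inj₂ V∈) , ts , refl)) with L , L∈ , refl ← ∈-map⁻ (lemma S) V∈ =
      subst id (sym (holds-sub (structure P) (point P) _ (matrix (lemma S L)))) (dne₀ λ ¬L → none (L , record
        { inLanguage = All.lookup target-lang L∈
        ; falseInM₁  = denote P ts , λ holds → ¬L
            (subst (λ e → Holds S (structure P) e (matrix (lemma S L))) (sym (denote-evals P ts)) holds)
        ; respectsT2 = proj₁ (consistent L∈)
        ; respectsT3 = proj₂ (consistent L∈)
        }))

  Ty2 : (L : Lemma S) → Pointed S 𝒯 (Signature.recArity S (antecedent L)) → Set₁
  Ty2 = Type2 S 𝒯 D A G α size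

  Ty3 : List (Lemma S) → (L : Lemma S) → Pointed S 𝒯 (Signature.recArity S (antecedent L)) → Set
  Ty3 = Type3 S 𝒯 D A G α size k

  type2-false : ∀ L {P} → Ty2 L P → ¬ Holds S (structure P) (point P) (matrix (lemma S L))
  type2-false ((R , _) ⊃ ψ) {M at c} (_ , _ , _ , _ , holds , ¬ψ) L-holds =
    ¬ψ (L-holds (subst (⟦rel⟧ M R) (sym (evals-vars M c)) holds))

  type2-consistent : ∀ L {M c} → Ty2 L (M at c) → ∀ {ψ} → (antecedent L ⊃ ψ) ∈ target →
    Holds S M c (matrix (lemma S (antecedent L ⊃ ψ)))
  type2-consistent L {M} {c} (model , _ , A-true , lfp , _) L∈ =
    FixpointInduction.lfp-induction em S 𝒯 D M lfp _
      (valid-sound (Γ []) (PFP S 𝒯 D _) (target-PFP L∈) M model ctx-true) c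
    where
    ctx-true : ∀ {V} → Γ [] V → True S M V
    ctx-true (inj₁ a)                 = A-true a
    ctx-true (inj₂ (inj₁ (R , refl))) = proj₁ lfp R

  -- Independence enters here: `target-PFP` starts from the context without lemmas, whose instances
  -- are among those for any `Ls`, so a failure at `c` would contradict it.
  type3-consistent : ∀ {Ls} L {M c} → Ty3 Ls L (M at c) → ∀ {ψ} → (antecedent L ⊃ ψ) ∈ target →
    Holds S M c (matrix (PFP S 𝒯 D (antecedent L ⊃ ψ)))
  type3-consistent {Ls} L {M} {c} (model , sat) {ψ} L∈ =
    dne₀ λ ¬PFP → target-PFP L∈ ((M at c) , model , sat′ ¬PFP)
    where
    sat′ : ¬ Holds S M c (matrix (PFP S 𝒯 D (antecedent L ⊃ ψ))) →
      ∀ {φ} → refutation S 𝒯 (Γ []) (PFP S 𝒯 D (antecedent L ⊃ ψ)) k φ → Holds S M c φ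
    sat′ ¬PFP (inj₁ (V , v , inst)) = sat (inj₁ (V , context-mono {Ls} v , inst))
    sat′ ¬PFP (inj₂ refl)           = ¬PFP

  Sound : List (Lemma S) → Set₁
  Sound Ls = ∀ i → _⊨_ S 𝒯 (Γ (take (toℕ i) Ls)) (PFP S 𝒯 D (lookup Ls i))

  TargetConsistent : Examples → Examples → Set₁
  TargetConsistent T2 T3 = ∀ {L} → L ∈ target → Consistent T2 T3 L

  add-type2 : ∀ {T2 T3} L {P} → Ty2 L P → TargetConsistent T2 T3 →
    TargetConsistent ((antecedent L , P) ∷ T2) T3
  add-type2 L t2 cons {L′} L∈ =
    (λ { (here refl) → type2-consistent L t2 {consequent L′} L∈
       ; (there p)   → proj₁ (cons L∈) p }) , proj₂ (cons L∈)

  add-type3 : ∀ {Ls T2 T3} L {P} → Ty3 Ls L P → TargetConsistent T2 T3 →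
    TargetConsistent T2 ((antecedent L , P) ∷ T3)
  add-type3 {Ls} L t3 cons {L′} L∈ = proj₁ (cons L∈) ,
    (λ { (here refl) → type3-consistent {Ls} L t3 {consequent L′} L∈
       ; (there p)   → proj₂ (cons L∈) p })

  FState : Set₁
  FState = State S 𝒯 D A G α size

  infix 4 _⇝_
  _⇝_ : FState → FState → Set₁
  _⇝_ = _⟶_ S 𝒯 D A G α size

  -- Depth and height are fixed at `k` and `h`, which excludes restarts; the Type-1 property and the
  -- candidacy of `L` are remembered for the steps that need them.
  data Invariant : FState → Set₁ where
    outer : ∀ {Ls T2 T3} → Sound Ls → TargetConsistent T2 T3 → Invariant (outer k h Ls T2 T3)
    inner : ∀ {Ls P T2 T3} → Sound Ls → TargetConsistent T2 T3 → Type1 S 𝒯 D A G α size k Ls P →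
      Invariant (inner k h Ls P T2 T3)
    check : ∀ {Ls P T2 T3 L} → Sound Ls → TargetConsistent T2 T3 → Type1 S 𝒯 D A G α size k Ls P →
      Cand P T2 T3 L → Invariant (check k h Ls P T2 T3 L)
    done  : ∀ {Ls} → Proves S 𝒯 D A Ls α → Invariant (done Ls)

  invariant-step : ∀ {s s′} → Invariant s → s ⇝ s′ → Invariant s′
  invariant-step (outer sound cons) (return valid) = done (valid-sound (Γ _) α valid , sound)
  invariant-step (outer sound cons) (type1 _ t1) = inner sound cons t1
  invariant-step (inner sound cons t1) (propose cand) = check sound cons t1 cand
  invariant-step (inner sound cons t1) (restart none) =
    let L , cand = candidate-exists t1 cons in contradiction cand (none L)
  invariant-step (check {Ls} {L = L} sound cons t1 cand) (accept valid) = outer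
    (take-lookup-∷ʳ (λ Ls L → _⊨_ S 𝒯 (Γ Ls) (PFP S 𝒯 D L)) Ls sound
      (valid-sound (Γ Ls) (PFP S 𝒯 D L) valid))
    λ L∈ → proj₁ (cons L∈) , λ ()
  invariant-step (check {L = L} sound cons t1 cand) (type2 _ t2) = inner sound (add-type2 L t2 cons) t1
  invariant-step (check {Ls} {L = L} sound cons t1 cand) (type3 _ t3) = inner sound (add-type3 {Ls} L t3 cons) t1

  invariant-run : ∀ {s s′} → Invariant s → Star _⇝_ s s′ → Invariant s′
  invariant-run inv ε          = inv
  invariant-run inv (st ◅ run) = invariant-run (invariant-step inv st) run

  -- Classically, an invalid query has a satisfying model, and this is a Type-1 or Type-3
  -- counterexample. A rejected lemma therefore always has a Type-3 counterexample, whether or not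
  -- the search for a Type-2 one would succeed.
  stuck⇒done : ∀ {s} → Invariant s → (∀ s′ → ¬ s ⇝ s′) →
    Σ[ Ls ∈ List (Lemma S) ] s ≡ done Ls × Proves S 𝒯 D A Ls α
  stuck⇒done (done proves) stuck = _ , refl , proves
  stuck⇒done (outer {Ls} sound cons) stuck with em {Valid S 𝒯 (Γ Ls) α k}
  ... | yes valid = contradiction (return valid) (stuck _)
  ... | no ¬valid = contradiction (type1 ¬valid (proj₂ (dne ¬valid))) (stuck _)
  stuck⇒done (inner sound cons t1) stuck =
    contradiction (propose (proj₂ (candidate-exists t1 cons))) (stuck _)
  stuck⇒done (check {Ls} {L = L} sound cons t1 cand) stuck with em {Valid S 𝒯 (Γ Ls) (PFP S 𝒯 D L) k}
  ... | yes valid = contradiction (accept valid) (stuck _)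
  ... | no ¬valid = contradiction (type3 ¬valid (proj₂ (dne ¬valid))) (stuck _)

  candidates : List (Lemma S)
  candidates = proj₁ (Language.langUpTo-finite S G em h)

  candidate-∈ : ∀ {P T2 T3 L} → Cand P T2 T3 L → L ∈ candidates
  candidate-∈ cand = proj₂ (Language.langUpTo-finite S G em h) _ (Candidate.inLanguage cand)

  unaccepted : List (Lemma S) → ℕ
  unaccepted Ls = count (λ L → dec (L ∉ Ls)) candidates

  unrefuted : Examples → Examples → ℕ
  unrefuted T2 T3 = count (λ L → em {Consistent T2 T3 L}) candidates

  unaccepted-decreases : ∀ {Ls L} → L ∈ candidates → L ∉ Ls → unaccepted (Ls ∷ʳ L) < unaccepted Ls
  unaccepted-decreases {Ls} {L} L∈ L∉ = count-strict (λ L′ → dec (L′ ∉ Ls ∷ʳ L)) (λ L′ → dec (L′ ∉ Ls))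
    (λ _ L′∉ L′∈ → L′∉ (∈-++⁺ˡ L′∈)) L∈ L∉ (λ L∉ → L∉ (∈-++⁺ʳ Ls (here refl)))

  unrefuted-decreases : ∀ {P T2 T3 T2′ T3′ L} → Cand P T2 T3 L → ¬ Consistent T2′ T3′ L →
    (∀ L′ → Consistent T2′ T3′ L′ → Consistent T2 T3 L′) → unrefuted T2′ T3′ < unrefuted T2 T3
  unrefuted-decreases cand ¬cons weaken = count-strict (λ L → em) (λ L → em) weaken
    (candidate-∈ cand) (Candidate.respectsT2 cand , Candidate.respectsT3 cand) ¬cons

  mutual
    -- The lexicographic descent: `m` bounds the unaccepted lemmas and `n` the unrefuted ones.
    -- Acceptance lowers the first count, a stored counterexample the second.
    acc-outer : ∀ m {Ls T2 T3} → Invariant (outer k h Ls T2 T3) → unaccepted Ls < m →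
      Acc (flip _⇝_) (outer k h Ls T2 T3)
    acc-outer (ℕ.suc m) inv (s≤s p) = acc λ
      { (return _)         → acc λ ()
      -- A fresh inner bound is taken, since acceptance empties the Type-3 examples and may raise
      -- the number of unrefuted lemmas.
      ; st@(type1 ¬valid t1) → acc-inner m _ (invariant-step inv st) p ≤-refl
      }

    acc-inner : ∀ m n {Ls P T2 T3} → Invariant (inner k h Ls P T2 T3) → unaccepted Ls ≤ m →
      unrefuted T2 T3 < n → Acc (flip _⇝_) (inner k h Ls P T2 T3)
    acc-inner m (ℕ.suc n) inv p (s≤s q) = acc λ
      { st@(propose _)    → acc-check m n (invariant-step inv st) p q
      ; st@(restart none) → restart-impossible inv none
      }

    restart-impossible : ∀ {Ls P T2 T3} {B : Set₁} → Invariant (inner k h Ls P T2 T3) → (∀ L → ¬ Cand P T2 T3 L) → B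
    restart-impossible (inner _ cons t1) none = let L , cand = candidate-exists t1 cons in contradiction cand (none L)

    acc-check : ∀ m n {Ls P T2 T3 L} → Invariant (check k h Ls P T2 T3 L) → unaccepted Ls ≤ m →
      unrefuted T2 T3 ≤ n → Acc (flip _⇝_) (check k h Ls P T2 T3 L)
    acc-check m n {T2 = T2} {T3} {L} inv@(check {Ls} _ _ t1 cand) p q = acc λ
      { st@(accept _) → acc-outer m (invariant-step inv st)
          (<-≤-trans (unaccepted-decreases (candidate-∈ cand) (candidate-fresh {Ls} t1 cand)) p)
      ; st@(type2 _ t2) → acc-inner m n (invariant-step inv st) p
          (<-≤-trans (unrefuted-decreases cand (λ cons → type2-false L t2 (proj₁ cons (here refl)))
            λ _ cons → (λ x → proj₁ cons (there x)) , proj₂ cons) q)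
      ; st@(type3 _ t3) → acc-inner m n (invariant-step inv st) p
          (<-≤-trans (unrefuted-decreases cand (λ cons → proj₂ t3 (inj₂ refl) (proj₂ cons (here refl)))
            λ _ cons → proj₁ cons , λ x → proj₂ cons (there x)) q)
      }

  terminates : TerminatesWith S 𝒯 D A G α size (λ Ls → Proves S 𝒯 D A Ls α)
    (initial S 𝒯 D A G α size k h)
  terminates = acc-outer _ start ≤-refl , λ run stuck → stuck⇒done (invariant-run start run) stuck
    where
    start : Invariant (initial S 𝒯 D A G α size k h)
    start = outer (λ ()) λ _ → (λ ()) , λ ()

-- Choice of the depth and the height

uniform-bound : ∀ {a ℓ} {A : Set a} (P : A → ℕ → Set ℓ) →
  (∀ {x m n} → m ≤ n → P x m → P x n) →
  ∀ xs → (∀ {x} → x ∈ xs → ∃[ k ] P x k) → ∃[ k ] (∀ {x} → x ∈ xs → P x k)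
uniform-bound P mono []       p = 0 , λ ()
uniform-bound P mono (x ∷ xs) p =
  let m , q = p (here refl)
      n , r = uniform-bound P mono xs λ x∈ → p (there x∈)
  in m ⊔ n , λ { (here refl) → mono (m≤m⊔n m n) q ; (there x∈) → mono (m≤n⊔m m n) (r x∈) }

theorem5p1 : ExcludedMiddle (suc 0ℓ) →
    (S : Signature) (𝒯 : Theories S) → QFDecidable S 𝒯 →
    (A : List (Universal S)) (D : Definitions S) (G : Grammar S) (α : Universal S)
    (size : ℕ) →
    ProvableByIndependentLemmas S 𝒯 D A G α →
    ∃[ k ] ∃[ h ]
    TerminatesWith S 𝒯 D A G α size
    (λ Ls → Proves S 𝒯 D A Ls α)
    (initial S 𝒯 D A G α size k h)
theorem5p1 em S 𝒯 _ A D G α size (Ls , inLang , proves , independent) =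
  let h , inLangUpTo = Language.lang⇒langUpTo S G inLang
      k₁ , α-valid   = herbrand (Γ Ls) α proves
      k₂ , PFP-valid = uniform-bound (λ L → Valid S 𝒯 (Γ []) (PFP S 𝒯 D L))
        (λ {L} → valid-mono (Γ []) (PFP S 𝒯 D L))
        Ls (λ {L} L∈ → herbrand (Γ []) (PFP S 𝒯 D L) (independent L∈))
  -- Validity persists at greater depths, so the maximum serves `α` and every PFP at once.
  in k₁ ⊔ k₂ , h , Fossil.terminates em S 𝒯 A D G α size Ls (k₁ ⊔ k₂) h inLangUpTo
       (valid-mono (Γ Ls) α (m≤m⊔n k₁ k₂) α-valid)
       (λ {L} L∈ → valid-mono (Γ []) (PFP S 𝒯 D L) (m≤n⊔m k₁ k₂) (PFP-valid L∈))
  where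
  open Herbrand em S 𝒯
  open Validity em S 𝒯
  Γ : List (Lemma S) → Pred (Universal S) 0ℓ
  Γ = context S 𝒯 D A
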